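{- Let $K$ be a number field. There is a finite set $S$ such that $\bar{\kappa}(a,K) \geq 6$ for all $a \in K \setminus (S \cap K)$, and $\bar{\kappa}(a,K) = 4$ for all $a \in S \cap K$.
   Context: For $c \in K$ let $f_c(x) = x^2 + c$ and $f_c^N$ its $N$-fold composition. For $a, c \in K$ let $P(a,c) = \{x \in K : f_c^N(x) = a \text{ for some } N \geq 1\}$. Define $\bar{\kappa}(a,K) = \inf_{F \subset K \text{ finite}} \sup_{c \in K \setminus F} \# P(a,c)$. -}

module Defs where

open import Level using (Level; _⊔_) renaming (suc to lsuc)
open import Data.Nat using (ℕ; zero; suc)
open import Data.Fin using (Fin)
import Data.Fin as Fin
open import Data.Product using (Σ; ∃; _×_; _,_)
open import Data.List using (List)
open import Relation.Nullary using (¬_)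
open import Relation.Binary.PropositionalEquality using (_≡_)
open import Data.Rational using (ℚ)
import Data.Rational as ℚ
open import Data.Rational.Properties using (+-*-rawRing)
open import Algebra.Bundles using (CommutativeRing)
open import Algebra.Morphism.Structures using (IsRingHomomorphism)
import Data.List.Membership.Setoid as SetoidMembership

sumR : ∀ {c ℓ} (R : CommutativeRing c ℓ) (n : ℕ) →
       (Fin n → CommutativeRing.Carrier R) → CommutativeRing.Carrier R
sumR R zero    g = CommutativeRing.0# R
sumR R (suc n) g = CommutativeRing._+_ R (g Fin.zero) (sumR R n (λ i → g (Fin.suc i)))

record NumberField (c ℓ : Level) : Set (lsuc (c ⊔ ℓ)) where
  field
    commRing : CommutativeRing c ℓ
  open CommutativeRing commRing public
  field
    0≉1       : ¬ (0# ≈ 1#)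
    inverse   : ∀ x → ¬ (x ≈ 0#) → ∃ λ y → x * y ≈ 1#
    ι         : ℚ → Carrier
    ι-hom     : IsRingHomomorphism +-*-rawRing rawRing ι
    dim       : ℕ
    basis     : Fin dim → Carrier
    spans     : ∀ x → ∃ λ (q : Fin dim → ℚ) → x ≈ sumR commRing dim (λ i → ι (q i) * basis i)
    independent : ∀ (q : Fin dim → ℚ) → sumR commRing dim (λ i → ι (q i) * basis i) ≈ 0#
                  → ∀ i → q i ≡ ℚ.0ℚ

module _ {c ℓ : Level} (K : NumberField c ℓ) where
  open NumberField K
  open SetoidMembership setoid using (_∈_; _∉_)

  f : Carrier → Carrier → Carrier
  f c x = x * x + c

  iter : ℕ → Carrier → Carrier → Carrier
  iter zero    c x = x
  iter (suc N) c x = f c (iter N c x)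

  InP : Carrier → Carrier → Carrier → Set ℓ
  InP a c x = ∃ λ N → iter (suc N) c x ≈ a

  CardAtLeast : ℕ → Carrier → Carrier → Set (c ⊔ ℓ)
  CardAtLeast k a c =
    Σ (Fin k → Carrier) λ xs →
      (∀ i → InP a c (xs i)) × (∀ i j → xs i ≈ xs j → i ≡ j)

  CardAtMost : ℕ → Carrier → Carrier → Set (c ⊔ ℓ)
  CardAtMost k a c = ¬ CardAtLeast (suc k) a c

  -- κ̄(a,K) ≥ k  (unfolding inf over finite F of sup over c ∉ F of #P(a,c) ≥ k,
  -- with #P valued in ℕ ∪ {∞}):  for every finite F there is c ∉ F with #P(a,c) ≥ k.
  KappaAtLeast : ℕ → Carrier → Set (c ⊔ ℓ)
  KappaAtLeast k a = ∀ (F : List Carrier) → ∃ λ c → c ∉ F × CardAtLeast k a c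

  KappaAtMost : ℕ → Carrier → Set (c ⊔ ℓ)
  KappaAtMost k a = ∃ λ (F : List Carrier) → ∀ c → c ∉ F → CardAtMost k a c

  KappaEq : ℕ → Carrier → Set (c ⊔ ℓ)
  KappaEq k a = KappaAtLeast k a × KappaAtMost k a

-- Write six elements of P(a,c) as ±u, ±v, ±w with f_c(u) = a, f_c(v) = u, f_c(w) = v.
-- Put v = u + s and c = a - u²; then v² = u - c reads u(1 - 2s) = s² + a, and
-- w² = v - c becomes, with A = 4a + 5 and 2w(1 - 2s) = x - 2(s² + s - a - 2), the equation
--   x² - 4x(s² + s) + (A + 3)x - 4As + 4A - 4 = 0,
-- which η = 2xs + x + A turns into η² = x³ + (A + 4)x² + (6A - 4)x + A².
-- Infinitely many points on this curve give infinitely many c, of which only finitely many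
-- make two of the six elements equal.
--
-- Every A admits a point with infinitely many distinct multiples 2ⁿP, so S is empty.
-- The doubling formula reads x(2P) = (x⁴ + 2(…)) / 4(…), so if the orbit of P = (x₀, η₀)
-- closes up or meets the 2-torsion, then a power of x₀ lies in 2R, where R is a ring
-- over which the curve and x₀ are defined. For the points (1 - A, 1) and (2 - A, A - 4) over
-- ℤ[A] this makes 2 a unit of ℤ[A], as 1 - A and 2 - A differ by 1. For (1 - A, 1) with
-- coordinate x/A over ℤ[1/A] it makes A integral over ℤ localised at 2. In
-- characteristic 0 both cannot hold.
module Submission where

open import Defs
open import Level using (Level; _⊔_)
open import Data.Nat using (ℕ; zero; suc)
open import Data.Fin using (Fin)
import Data.Fin as Fin
open import Data.Product using (∃; Σ; _×_; _,_; proj₁; proj₂; ∃₂)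
open import Data.Sum using (_⊎_; inj₁; inj₂; [_,_])
open import Data.Empty using (⊥; ⊥-elim)
open import Data.Maybe using (Maybe; just; nothing)
open import Data.Integer using (ℤ; +_; -[1+_])
import Data.Integer as ℤ
import Data.Integer.Properties as ℤ
open import Data.Rational using (ℚ; toℚᵘ; 0ℚ)
import Data.Rational as ℚ
import Data.Rational.Properties as ℚ
import Data.Rational.Unnormalised as ℚᵘ
import Data.Rational.Unnormalised.Properties as ℚᵘ
open import Relation.Nullary using (¬_; Dec; yes; no)
import Data.Fin.Properties as Fin
open import Relation.Binary.PropositionalEquality using (_≡_; cong; cong₂; subst) renaming (refl to ≡-refl; sym to ≡-sym; trans to ≡-trans)
import Algebra.Properties.Ring as RingProps
import Algebra.Solver.Ring as RingSolver
open import Algebra.Solver.Ring.AlmostCommutativeRing using (fromCommutativeRing; _-Raw-AlmostCommutative⟶_)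
open import Algebra.Morphism.Structures using (IsRingHomomorphism)
import Data.Nat as ℕ
import Data.Nat.Properties as ℕ
open import Data.List using (List; []; _∷_; _++_)
open import Data.List.Relation.Unary.All using (All; []; _∷_)
open import Data.List.Relation.Unary.Any using (Any; here; there)
open import Data.List.Relation.Unary.All.Properties using (All¬⇒¬Any; ++⁻ˡ; ++⁻ʳ)
import Data.List.Relation.Unary.All as All
import Data.List.Membership.Setoid as SetoidMembership
open import Data.Vec using (Vec; []; _∷_; lookup)
import Data.Vec.Relation.Unary.All as VecAll
import Data.Vec.Relation.Unary.All.Properties as VecAll
open import Data.Vec.Relation.Unary.AllPairs using ([]; _∷_)
open import Data.Vec.Relation.Unary.Unique.Setoid using (Unique)
open import Data.Vec.Relation.Unary.Unique.Setoid.Properties using (lookup-injective)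

-- Integers as rational numbers.

fromℤ : ℤ → ℚ
fromℤ n = n ℚ./ 1

-- Normalised fractions do not reduce for a variable numerator, so the ring laws of `fromℤ` are
-- checked on unnormalised representatives, to which this passes.
toℚᵘ-fromℤ : ∀ n → toℚᵘ (fromℤ n) ℚᵘ.≃ ℚᵘ.mkℚᵘ n 0
toℚᵘ-fromℤ n = ℚ.toℚᵘ-fromℚᵘ (ℚᵘ.mkℚᵘ n 0)

fromℤ-homo-+ : ∀ m n → fromℤ (m ℤ.+ n) ≡ fromℤ m ℚ.+ fromℤ n
fromℤ-homo-+ m n = ℚ.toℚᵘ-injective (begin
  toℚᵘ (fromℤ (m ℤ.+ n))                 ≈⟨ toℚᵘ-fromℤ (m ℤ.+ n) ⟩
  ℚᵘ.mkℚᵘ (m ℤ.+ n) 0                   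
        ≈⟨ ℚᵘ.*≡* (cong (ℤ._* ℤ.1ℤ) (cong₂ ℤ._+_ (≡-sym (ℤ.*-identityʳ m)) (≡-sym (ℤ.*-identityʳ n)))) ⟩
  ℚᵘ.mkℚᵘ m 0 ℚᵘ.+ ℚᵘ.mkℚᵘ n 0           ≈⟨ ℚᵘ.+-cong (toℚᵘ-fromℤ m) (toℚᵘ-fromℤ n) ⟨
  toℚᵘ (fromℤ m) ℚᵘ.+ toℚᵘ (fromℤ n)     ≈⟨ ℚ.toℚᵘ-homo-+ (fromℤ m) (fromℤ n) ⟨
  toℚᵘ (fromℤ m ℚ.+ fromℤ n)             ∎)
  where open ℚᵘ.≃-Reasoning

fromℤ-homo-* : ∀ m n → fromℤ (m ℤ.* n) ≡ fromℤ m ℚ.* fromℤ n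
fromℤ-homo-* m n = ℚ.toℚᵘ-injective (begin
  toℚᵘ (fromℤ (m ℤ.* n))                 ≈⟨ toℚᵘ-fromℤ (m ℤ.* n) ⟩
  ℚᵘ.mkℚᵘ m 0 ℚᵘ.* ℚᵘ.mkℚᵘ n 0           ≈⟨ ℚᵘ.*-cong (toℚᵘ-fromℤ m) (toℚᵘ-fromℤ n) ⟨
  toℚᵘ (fromℤ m) ℚᵘ.* toℚᵘ (fromℤ n)     ≈⟨ ℚ.toℚᵘ-homo-* (fromℤ m) (fromℤ n) ⟨
  toℚᵘ (fromℤ m ℚ.* fromℤ n)             ∎)
  where open ℚᵘ.≃-Reasoning

fromℤ-homo-neg : ∀ n → fromℤ (ℤ.- n) ≡ ℚ.- fromℤ n
fromℤ-homo-neg n = ℚ.toℚᵘ-injective (begin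
  toℚᵘ (fromℤ (ℤ.- n))       ≈⟨ toℚᵘ-fromℤ (ℤ.- n) ⟩
  ℚᵘ.- ℚᵘ.mkℚᵘ n 0           ≈⟨ ℚᵘ.-‿cong (toℚᵘ-fromℤ n) ⟨
  ℚᵘ.- toℚᵘ (fromℤ n)        ≈⟨ ℚ.toℚᵘ-homo‿- (fromℤ n) ⟨
  toℚᵘ (ℚ.- fromℤ n)         ∎)
  where open ℚᵘ.≃-Reasoning

fromℤ-injective : ∀ m n → fromℤ m ≡ fromℤ n → m ≡ n
fromℤ-injective m n eq with ℚᵘ.≃-trans (ℚᵘ.≃-sym (toℚᵘ-fromℤ m)) (ℚᵘ.≃-trans (ℚᵘ.≃-reflexive (cong toℚᵘ eq)) (toℚᵘ-fromℤ n))
... | ℚᵘ.*≡* e = ≡-trans (≡-sym (ℤ.*-identityʳ m)) (≡-trans e (ℤ.*-identityʳ n))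

-- Arithmetic, decidable equality and ring normalisation in a number field.

module Field {c ℓ : Level} (K : NumberField c ℓ) where
  open NumberField K public
  module ι = IsRingHomomorphism ι-hom
  open RingProps ring public using (x∙y⁻¹≈ε⇒x≈y; +-cancelʳ)

  -- The image of a nonzero rational has an inverse, the image of the reciprocal, so it cannot
  -- vanish while `0 ≠ 1`. Thus the characteristic is 0.
  ι-injective : ∀ q → ι q ≈ 0# → q ≡ 0ℚ
  ι-injective q ιq≈0 with q ℚ.≟ 0ℚ
  ... | yes q≡0 = q≡0
  ... | no  q≢0 = ⊥-elim (0≉1 (begin
    0#                    ≈⟨ zeroˡ _ ⟨
    0# * ι (ℚ.1/ q)       ≈⟨ *-congʳ ιq≈0 ⟨
    ι q * ι (ℚ.1/ q)      ≈⟨ ι.*-homo q (ℚ.1/ q) ⟨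
    ι (q ℚ.* (ℚ.1/ q))    ≈⟨ ι.⟦⟧-cong (ℚ.*-inverseʳ q) ⟩
    ι ℚ.1ℚ                ≈⟨ ι.1#-homo ⟩
    1#                    ∎))
    where
    open import Relation.Binary.Reasoning.Setoid setoid
    instance
      q-nonZero : ℚ.NonZero q
      q-nonZero = ℚ.≢-nonZero q≢0

  abstract
    -- Opaque, so that checking a polynomial identity never unfolds the arithmetic of `ℚ`.
    # : ℤ → Carrier
    # n = ι (fromℤ n)

    #-injective₀ : ∀ n → # n ≈ 0# → n ≡ ℤ.0ℤ
    #-injective₀ n e = fromℤ-injective n ℤ.0ℤ (ι-injective (fromℤ n) e)

    #-homo-+ : ∀ m n → # (m ℤ.+ n) ≈ # m + # n
    #-homo-+ m n = trans (ι.⟦⟧-cong (fromℤ-homo-+ m n)) (ι.+-homo _ _)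

    #-homo-* : ∀ m n → # (m ℤ.* n) ≈ # m * # n
    #-homo-* m n = trans (ι.⟦⟧-cong (fromℤ-homo-* m n)) (ι.*-homo _ _)

    #-homo-neg : ∀ n → # (ℤ.- n) ≈ - # n
    #-homo-neg n = trans (ι.⟦⟧-cong (fromℤ-homo-neg n)) (ι.-‿homo _)

    #-0 : # (+ 0) ≈ 0#
    #-0 = ι.0#-homo

    #-1 : # (+ 1) ≈ 1#
    #-1 = ι.1#-homo

  coeff≟ : ∀ m n → Maybe (# m ≈ # n)
  coeff≟ m n with m ℤ.≟ n
  ... | yes ≡-refl = just refl
  ... | no  _      = nothing

  #-morphism : ℤ.+-*-rawRing -Raw-AlmostCommutative⟶ fromCommutativeRing commRing
  #-morphism = record
    { ⟦_⟧    = #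
    ; +-homo = #-homo-+
    ; *-homo = #-homo-*
    ; -‿homo = #-homo-neg
    ; 0-homo = #-0
    ; 1-homo = #-1
    }

  open RingSolver ℤ.+-*-rawRing (fromCommutativeRing commRing) #-morphism coeff≟ public

  :0 :1 :2 :3 :4 : ∀ {n} → Polynomial n
  :0 = con (+ 0)
  :1 = con (+ 1)
  :2 = con (+ 2)
  :3 = con (+ 3)
  :4 = con (+ 4)

  sumR-0 : ∀ n (g : Fin n → Carrier) → (∀ i → g i ≈ 0#) → sumR commRing n g ≈ 0#
  sumR-0 zero    g g≈0 = refl
  sumR-0 (suc n) g g≈0 = trans (+-cong (g≈0 Fin.zero) (sumR-0 n _ (λ i → g≈0 (Fin.suc i)))) (+-identityˡ 0#)

  -- Rational coordinates in the basis decide this: by independence, a nonzero coordinate excludes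
  -- zero. The later case distinctions on elements of `K` rest on it.
  ≈0? : ∀ x → Dec (x ≈ 0#)
  ≈0? x with spans x
  ... | q , x≈Σ with Fin.all? (λ i → q i ℚ.≟ 0ℚ)
  ...   | yes q≡0 = yes (trans x≈Σ (sumR-0 dim _ (λ i →
                      trans (*-congʳ (trans (ι.⟦⟧-cong (q≡0 i)) ι.0#-homo)) (zeroˡ _))))
  ...   | no  q≢0 = no (λ x≈0 → q≢0 (independent q (trans (sym x≈Σ) x≈0)))

  open import Algebra.Properties.Semiring.Exp semiring public using (_^_; ^-homo-*)

  infix 4 _≟_
  _≟_ : ∀ x y → Dec (x ≈ y)
  x ≟ y with ≈0? (x - y)
  ... | yes e = yes (x∙y⁻¹≈ε⇒x≈y x y e)
  ... | no ne = no (λ e → ne (trans (+-congʳ e) (-‿inverseʳ y)))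

  integral : ∀ {x y} → x * y ≈ 0# → ¬ (x ≈ 0#) → y ≈ 0#
  integral {x} {y} xy≈0 x≉0 with inverse x x≉0
  ... | z , xz≈1 = begin
    y            ≈⟨ *-identityˡ y ⟨
    1# * y       ≈⟨ *-congʳ xz≈1 ⟨
    x * z * y    ≈⟨ solve 3 (λ x y z → x :* z :* y := z :* (x :* y)) refl x y z ⟩
    z * (x * y)  ≈⟨ *-congˡ xy≈0 ⟩
    z * 0#       ≈⟨ zeroʳ z ⟩
    0#           ∎
    where open import Relation.Binary.Reasoning.Setoid setoid

  zero-product : ∀ {x y} → x * y ≈ 0# → (x ≈ 0#) ⊎ (y ≈ 0#)
  zero-product {x} xy≈0 with ≈0? x
  ... | yes x≈0 = inj₁ x≈0
  ... | no  x≉0 = inj₂ (integral xy≈0 x≉0)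

  *-≉0 : ∀ {x y} → ¬ (x ≈ 0#) → ¬ (y ≈ 0#) → ¬ (x * y ≈ 0#)
  *-≉0 x≉0 y≉0 xy≈0 = y≉0 (integral xy≈0 x≉0)

  *-cancelˡ-≉0 : ∀ {x y z} → ¬ (x ≈ 0#) → x * y ≈ x * z → y ≈ z
  *-cancelˡ-≉0 {x} {y} {z} x≉0 e = x∙y⁻¹≈ε⇒x≈y y z (integral
    (trans (solve 3 (λ x y z → x :* (y :- z) := x :* y :- x :* z) refl x y z)
           (trans (+-congʳ e) (-‿inverseʳ _))) x≉0)

  -- Linear combination: l ≈ r is a combination of hypotheses with p - q = l - r as polynomials.
  from : ∀ {l r p q} → l ≈ r → p + r ≈ q + l → p ≈ q
  from {l} {r} {p} {q} l≈r e = +-cancelʳ r p q (trans e (+-congˡ l≈r))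

  infixr 7 _⊙_
  _⊙_ : ∀ {x y} k → x ≈ y → k * x ≈ k * y
  k ⊙ e = *-congˡ e

  infixl 6 _⊕_
  _⊕_ : ∀ {x y z w} → x ≈ y → z ≈ w → x + z ≈ y + w
  _⊕_ = +-cong

  #≉0 : ∀ n → ¬ (n ≡ ℤ.0ℤ) → ¬ (# n ≈ 0#)
  #≉0 n n≢0 e = n≢0 (#-injective₀ n e)

  1≉0 : ¬ (# (+ 1) ≈ 0#)
  1≉0 = #≉0 (+ 1) (λ ())

  2≉0 : ¬ (# (+ 2) ≈ 0#)
  2≉0 = #≉0 (+ 2) (λ ())

-- Divisibility by 2 and integrality over `ℤ[ b ]`.

module Integrality {c ℓ : Level} (K : NumberField c ℓ) where
  open Field K

  data ℤ[_] (b : Carrier) : Carrier → Set (c ⊔ ℓ) where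
    int  : ∀ n → ℤ[ b ] (# n)
    gen  : ℤ[ b ] b
    add  : ∀ {x y} → ℤ[ b ] x → ℤ[ b ] y → ℤ[ b ] (x + y)
    mul  : ∀ {x y} → ℤ[ b ] x → ℤ[ b ] y → ℤ[ b ] (x * y)
    resp : ∀ {x y} → x ≈ y → ℤ[ b ] x → ℤ[ b ] y

  2ℤ[_] : Carrier → Carrier → Set (c ⊔ ℓ)
  2ℤ[ b ] y = ∃ λ h → ℤ[ b ] h × y ≈ # (+ 2) * h

  2ℤ-resp : ∀ {b x y} → x ≈ y → 2ℤ[ b ] x → 2ℤ[ b ] y
  2ℤ-resp x≈y (h , h∈ , e) = h , h∈ , trans (sym x≈y) e

  2ℤ-add : ∀ {b x y} → 2ℤ[ b ] x → 2ℤ[ b ] y → 2ℤ[ b ] (x + y)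
  2ℤ-add (h , h∈ , e) (h′ , h′∈ , e′) = h + h′ , add h∈ h′∈ ,
    trans (+-cong e e′) (solve 2 (λ h h′ → :2 :* h :+ :2 :* h′ := :2 :* (h :+ h′)) refl h h′)

  2ℤ-scale : ∀ {b x y} → ℤ[ b ] x → 2ℤ[ b ] y → 2ℤ[ b ] (x * y)
  2ℤ-scale {x = x} x∈ (h , h∈ , e) = x * h , mul x∈ h∈ ,
    trans (*-congˡ e) (solve 2 (λ x h → x :* (:2 :* h) := :2 :* (x :* h)) refl x h)

  neg : ∀ {b x} → ℤ[ b ] x → ℤ[ b ] (- x)
  neg {x = x} x∈ = resp (solve 1 (λ x → con (-[1+ 0 ]) :* x := :- x) refl x) (mul (int -[1+ 0 ]) x∈)

  pow : ∀ {b x} k → ℤ[ b ] x → ℤ[ b ] (x ^ k)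
  pow zero    x∈ = resp #-1 (int (+ 1))
  pow (suc k) x∈ = mul x∈ (pow k x∈)

  -- Modulo 2 the elements u and v are nilpotent, but differ by 1.
  comaximal : ∀ {b u v} j k → ℤ[ b ] u → ℤ[ b ] v → u ≈ # (+ 1) + v →
              2ℤ[ b ] (u ^ j) → 2ℤ[ b ] (v ^ k) → 2ℤ[ b ] 1#
  comaximal {b} {u} {v} zero    k u∈ v∈ u≈1+v uʲ vᵏ = uʲ
  comaximal {b} {u} {v} (suc j) k u∈ v∈ u≈1+v uʲ vᵏ =
    comaximal j k u∈ v∈ u≈1+v (cancel k (u ^ j) (pow j u∈) uʲ (2ℤ-resp (*-comm _ _) (2ℤ-scale (pow j u∈) vᵏ))) vᵏ
    where
    -- As `y = u y - v y`, it is enough that 2 divides `v y`, and for `v y` in place of `y` the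
    -- exponent `k` drops by one.
    cancel : ∀ k y → ℤ[ b ] y → 2ℤ[ b ] (u * y) → 2ℤ[ b ] (v ^ k * y) → 2ℤ[ b ] y
    cancel zero    y y∈ uy vᵏy = 2ℤ-resp (*-identityˡ y) vᵏy
    cancel (suc k) y y∈ uy vᵏy = 2ℤ-resp
      (from (*-congʳ {x = y} u≈1+v)
        (solve 3 (λ u v y → u :* y :+ con -[1+ 0 ] :* (v :* y) :+ (:1 :+ v) :* y := y :+ u :* y) refl u v y))
      (2ℤ-add uy (2ℤ-scale (int -[1+ 0 ]) vy))
      where
      vy : 2ℤ[ b ] (v * y)
      vy = cancel k (v * y) (mul v∈ y∈)
        (2ℤ-resp (solve 3 (λ u v y → v :* (u :* y) := u :* (v :* y)) refl u v y) (2ℤ-scale v∈ uy))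
        (2ℤ-resp (solve 3 (λ v y p → v :* p :* y := p :* (v :* y)) refl v y (v ^ k)) vᵏy)

  -- The additive group generated by `1, b, …, bᵐ⁻¹`, in Horner form with the constant coefficient
  -- outermost. Powers of `b` may be dependent, so the coefficients belong to the derivation and not
  -- to the element.
  data Span (b : Carrier) : ℕ → Carrier → Set (c ⊔ ℓ) where
    nil  : ∀ {y} → y ≈ # (+ 0) → Span b 0 y
    cons : ∀ {m y z} n → Span b m z → y ≈ # n + b * z → Span b (suc m) y

  module _ {b : Carrier} where

    span-resp : ∀ {m y z} → y ≈ z → Span b m y → Span b m z
    span-resp y≈z (nil e)      = nil (trans (sym y≈z) e)
    span-resp y≈z (cons n s e) = cons n s (trans (sym y≈z) e)

    weaken : ∀ {m y} → Span b m y → Span b (suc m) y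
    weaken (nil e)      = cons (+ 0) (nil refl) (trans e (solve 1 (λ b → :0 := :0 :+ b :* :0) refl b))
    weaken (cons n s e) = cons n (weaken s) e

    weaken+ : ∀ d {m y} → Span b m y → Span b (d ℕ.+ m) y
    weaken+ zero    s = s
    weaken+ (suc d) s = weaken (weaken+ d s)

    span-0 : ∀ m → Span b m (# (+ 0))
    span-0 zero    = nil refl
    span-0 (suc m) = weaken (span-0 m)

    span-+ : ∀ {m y z} → Span b m y → Span b m z → Span b m (y + z)
    span-+ (nil e) (nil e′) = nil (trans (+-cong e e′) (solve 0 (:0 :+ :0 := :0) refl))
    span-+ (cons {z = z} n s e) (cons {z = z′} n′ s′ e′) = cons (n ℤ.+ n′) (span-+ s s′)
      (trans (+-cong e e′) (trans
        (solve 5 (λ n n′ b z z′ → (n :+ b :* z) :+ (n′ :+ b :* z′)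
              := (n :+ n′) :+ b :* (z :+ z′)) refl (# n) (# n′) b z z′)
        (+-congʳ (sym (#-homo-+ n n′)))))

    span-scale : ∀ {m y} k → Span b m y → Span b m (# k * y)
    span-scale k (nil e) = nil (trans (*-congˡ e) (solve 1 (λ k → k :* :0 := :0) refl (# k)))
    span-scale k (cons {z = z} n s e) = cons (k ℤ.* n) (span-scale k s)
      (trans (*-congˡ e) (trans
        (solve 4 (λ k n b z → k :* (n :+ b :* z) := k :* n :+ b :* (k :* z)) refl (# k) (# n) b z)
        (+-congʳ (sym (#-homo-* k n)))))

    shift : ∀ {m y} → Span b m y → Span b (suc m) (b * y)
    shift {y = y} s = cons (+ 0) s (solve 2 (λ b y → b :* y := :0 :+ b :* y) refl b y)

    span-int : ∀ m n → Span b (suc m) (# n)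
    span-int m n = cons n (span-0 m) (solve 2 (λ n b → n := n :+ b :* :0) refl (# n) b)

    span-* : ∀ {m n y z} → Span b m y → Span b n z → Span b (m ℕ.+ n) (y * z)
    span-* {n = n} {z = z} (nil e) t = span-resp
      (trans (solve 1 (λ z → :0 := :0 :* z) refl z) (*-congʳ (sym e))) (span-0 n)
    span-* {m = suc m} {z = z} (cons {z = y′} k s e) t = span-resp
      (trans (solve 4 (λ k b y z → k :* z :+ b :* (y :* z)
            := (k :+ b :* y) :* z) refl (# k) b y′ z) (*-congʳ (sym e)))
      (span-+ (span-scale k (weaken+ (suc m) t)) (shift (span-* s t)))

    span-^ : ∀ m → Span b (suc m) (b ^ m)
    span-^ zero    = span-resp #-1 (span-int 0 (+ 1))
    span-^ (suc m) = shift (span-^ m)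

    top : ∀ m {y} → Span b (suc m) y → ∃₂ λ n z → Span b m z × y ≈ # n * b ^ m + z
    top zero (cons {z = z} n (nil z≈0) e) = n , # (+ 0) , nil refl ,
      trans e (trans (+-congˡ (*-congˡ z≈0)) (trans
        (solve 2 (λ n b → n :+ b :* :0 := n :* :1 :+ :0) refl (# n) b)
        (+-congʳ (*-congˡ #-1))))
    top (suc m) (cons n s e) with top m s
    ... | n′ , z′ , s′ , e′ = n′ , # n + b * z′ , cons n s′ refl ,
      trans e (trans (+-congˡ (*-congˡ e′))
        (solve 5 (λ n b n′ p z → n :+ b :* (n′ :* p :+ z)
              := n′ :* (b :* p) :+ (n :+ b :* z)) refl (# n) b (# n′) (b ^ m) z′))

    ℤ⇒Span : ∀ {y} → ℤ[ b ] y → ∃ λ m → Span b m y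
    ℤ⇒Span (int n) = 1 , span-int 0 n
    ℤ⇒Span gen     = 2 , cons (+ 0) (span-int 0 (+ 1)) (solve 1 (λ b → b := :0 :+ b :* :1) refl b)
    ℤ⇒Span (add {y = z} y∈ z∈) with ℤ⇒Span y∈ | ℤ⇒Span z∈
    ... | m , s | n , t = n ℕ.+ m , span-+ (weaken+ n s) (subst (λ k → Span b k z) (ℕ.+-comm m n) (weaken+ m t))
    ℤ⇒Span (mul y∈ z∈) with ℤ⇒Span y∈ | ℤ⇒Span z∈
    ... | m , s | n , t = m ℕ.+ n , span-* s t
    ℤ⇒Span (resp e y∈) with ℤ⇒Span y∈
    ... | m , s = m , span-resp e s

  -- The clash between 2 being invertible and integrality at 2.

  Odd : Carrier → Set ℓ
  Odd y = ∃ λ k → y ≈ # (+ 1) + # (+ 2) * # k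

  odd-* : ∀ {y z} → Odd y → Odd z → Odd (y * z)
  odd-* {y} {z} (k , e) (k′ , e′) = k ℤ.+ k′ ℤ.+ + 2 ℤ.* (k ℤ.* k′) ,
    trans (*-cong e e′) (trans
      (solve 2 (λ k k′ → (:1 :+ :2 :* k) :* (:1 :+ :2 :* k′)
            := :1 :+ :2 :* (k :+ k′ :+ :2 :* (k :* k′))) refl (# k) (# k′))
      (+-congˡ (*-congˡ (sym (trans (#-homo-+ _ _) (+-cong (#-homo-+ k k′)
        (trans (#-homo-* _ _) (*-congˡ (#-homo-* k k′)))))))))

  odd-+2 : ∀ {y} k → Odd y → Odd (y + # (+ 2) * # k)
  odd-+2 k (k′ , e) = k′ ℤ.+ k , trans (+-congʳ e) (trans
    (solve 2 (λ k k′ → :1 :+ :2 :* k′ :+ :2 :* k := :1 :+ :2 :* (k′ :+ k)) refl (# k) (# k′))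
    (+-congˡ (*-congˡ (sym (#-homo-+ k′ k)))))

  odd-int : ∀ {y} → Odd y → ∃ λ n → y ≈ # n
  odd-int (k , e) = + 1 ℤ.+ + 2 ℤ.* k , trans e (sym (trans (#-homo-+ _ _) (+-congˡ (#-homo-* _ _))))

  1+2k≢0 : ∀ k → ¬ (+ 1 ℤ.+ + 2 ℤ.* k ≡ ℤ.0ℤ)
  1+2k≢0 (+ zero)  ()
  1+2k≢0 (+ suc n) ()
  1+2k≢0 -[1+ zero ] ()
  1+2k≢0 -[1+ suc n ] ()

  odd≉0 : ∀ {y} → Odd y → ¬ (y ≈ # (+ 0))
  odd≉0 o@(k , e) y≈0 = 1+2k≢0 k (#-injective₀ _ (trans (sym (proj₂ (odd-int o))) (trans y≈0 #-0)))

  -- In `α b d` and `β b m` an odd integer lies in 2 ⟨1, …, bᵈ⁻¹⟩, respectively an odd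
  -- multiple of bᵐ lies in ⟨1, …, bᵐ⁻¹⟩. They contradict each other by Euclid's
  -- algorithm: β reduces the top coefficient of α, and α the bottom one of β.
  α β : Carrier → ℕ → Set (c ⊔ ℓ)
  α b d = ∃₂ λ o g → Odd o × Span b d g × o ≈ # (+ 2) * g
  β b m = ∃ λ o → Odd o × Span b m (o * b ^ m)

  module _ {b : Carrier} where

    β-suc : ∀ {m} → β b m → β b (suc m)
    β-suc {m} (o , odd , s) = o , odd ,
      span-resp (solve 3 (λ b o p → b :* (o :* p) := o :* (b :* p)) refl b o (b ^ m)) (shift s)

    β-+ : ∀ j {m} → β b m → β b (j ℕ.+ m)
    β-+ zero    s = s
    β-+ (suc j) s = β-suc (β-+ j s)

    α-+ : ∀ j {d} → α b d → α b (j ℕ.+ d)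
    α-+ j (o , g , odd , s , e) = o , g , odd , weaken+ j s , e

    -- Write `g = γ bᵈ + z` and multiply `o = 2 g` by the odd `o′` of `β`: the top term becomes
    -- `γ (o′ bᵈ)`, which `β` rewrites in lower powers.
    α-pred : ∀ {d} → β b d → α b (suc d) → α b d
    α-pred {d} (o′ , odd′ , s′) (o , g , odd , s , e) with top d s | odd-int odd′
    ... | γ , z , sz , g≈ | n , o′≈n =
      o′ * o , # γ * (o′ * b ^ d) + o′ * z , odd-* odd′ odd ,
      span-+ (span-scale γ s′) (span-resp (*-congʳ (sym o′≈n)) (span-scale n sz)) ,
      trans (*-congˡ (trans e (*-congˡ g≈)))
        (solve 4 (λ o γ p z → o :* (:2 :* (γ :* p :+ z)) := :2 :* (γ :* (o :* p) :+ o :* z)) refl o′ (# γ) (b ^ d) z)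

    α-reduce : ∀ j {m} → β b m → α b (j ℕ.+ m) → α b m
    α-reduce zero    β-m α-m = α-m
    α-reduce (suc j) β-m α-j = α-reduce j β-m (α-pred (β-+ j β-m) α-j)

    -- Moving the constant term of `2 g` to the left leaves an odd `o₁ = 2 b g′`. Multiplying the
    -- relation of `β` by `o₁` makes its constant term `n o₁` divisible by `b`, and then one factor
    -- `b` cancels.
    β-pred : ∀ {m} → ¬ (b ≈ 0#) → α b (suc m) → β b (suc m) → β b m
    β-pred {m} b≉0 (o , g , odd , cons {z = g′} g₀ sg g≈ , e) (o′ , odd′ , cons {z = y} n sy o′b≈) =
      o₁ * o′ , odd-* odd₁ odd′ ,
      span-resp (*-cancelˡ-≉0 b≉0 (sym b-times)) (span-+ (span-scale (+ 2 ℤ.* n) sg) (span-resp (*-congʳ (sym o₁≈)) (span-scale n₁ sy)))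
      where
      o₁ : Carrier
      o₁ = o + # (+ 2) * # (ℤ.- g₀)
      odd₁ : Odd o₁
      odd₁ = odd-+2 (ℤ.- g₀) odd
      n₁ = proj₁ (odd-int odd₁)
      o₁≈ : o₁ ≈ # n₁
      o₁≈ = proj₂ (odd-int odd₁)
      o₁≈2bg′ : o₁ ≈ # (+ 2) * (b * g′)
      o₁≈2bg′ = trans (+-cong (trans e (*-congˡ g≈)) (*-congˡ (#-homo-neg g₀)))
        (solve 3 (λ g₀ b g′ → :2 :* (g₀ :+ b :* g′) :+ :2 :* (:- g₀) := :2 :* (b :* g′)) refl (# g₀) b g′)
      b-times : b * (o₁ * o′ * b ^ m) ≈ b * (# (+ 2 ℤ.* n) * g′ + o₁ * y)
      b-times = begin
        b * (o₁ * o′ * b ^ m)                    ≈⟨ solve 4 (λ b o₁ o′ p → b :* (o₁ :* o′ :* p)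
              := o₁ :* (o′ :* (b :* p))) refl b o₁ o′ (b ^ m) ⟩
        o₁ * (o′ * b ^ suc m)                    ≈⟨ *-congˡ o′b≈ ⟩
        o₁ * (# n + b * y)                       ≈⟨ solve 4 (λ o₁ n b y → o₁ :* (n :+ b :* y)
              := n :* o₁ :+ b :* (o₁ :* y)) refl o₁ (# n) b y ⟩
        # n * o₁ + b * (o₁ * y)                  ≈⟨ +-congʳ (*-congˡ o₁≈2bg′) ⟩
        # n * (# (+ 2) * (b * g′)) + b * (o₁ * y) ≈⟨ solve 5 (λ n b g′ o₁ y → n :* (:2 :* (b :* g′)) :+ b :* (o₁ :* y)
              := b :* (:2 :* n :* g′ :+ o₁ :* y)) refl (# n) b g′ o₁ y ⟩
        b * (# (+ 2) * # n * g′ + o₁ * y)        ≈⟨ *-congˡ (+-congʳ (*-congʳ (#-homo-* (+ 2) n))) ⟨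
        b * (# (+ 2 ℤ.* n) * g′ + o₁ * y)        ∎
        where open import Relation.Binary.Reasoning.Setoid setoid

    -- At equal size, `α` lowers `β` and the lowered `β` lowers `α`. At size 0, `β` says that an odd
    -- integer is zero.
    αβ-absurd : ∀ m → ¬ (b ≈ 0#) → β b m → α b m → ⊥
    αβ-absurd zero b≉0 (o , odd , nil e) α-0 =
      odd≉0 odd (trans (sym (*-identityʳ o)) e)
    αβ-absurd (suc m) b≉0 β-m α-m = αβ-absurd m b≉0 β-m′ (α-pred β-m′ α-m)
      where β-m′ = β-pred b≉0 α-m β-m

    -- Padding `α` by `m` makes its reduction by `β` end exactly at size `m`, where the two can be
    -- compared.
    α-β-absurd : ∀ {d m} → ¬ (b ≈ 0#) → α b d → β b m → ⊥
    α-β-absurd {d} {m} b≉0 α-d β-m = αβ-absurd m b≉0 β-m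
      (α-reduce d β-m (subst (α b) (ℕ.+-comm m d) (α-+ m α-d)))

    -- At `b = 0` only the constant term of `g` survives, and an odd integer would be twice an
    -- integer.
    α-≉0 : ∀ {d} → α b d → ¬ (b ≈ 0#)
    α-≉0 (o , g , odd , nil g≈ , e) b≈0 = odd≉0 odd
      (trans e (trans (*-congˡ g≈) (solve 0 (:2 :* :0 := :0) refl)))
    α-≉0 (o , g , odd , cons {z = z} n s g≈ , e) b≈0 = odd≉0 (odd-+2 (ℤ.- n) odd)
      (trans (+-cong (trans e (*-congˡ (trans g≈ (+-congˡ (*-congʳ (trans b≈0 (sym #-0))))))) (*-congˡ (#-homo-neg n)))
        (solve 2 (λ n z → :2 :* (n :+ :0 :* z) :+ :2 :* (:- n) := :0) refl (# n) z))

    1∈2ℤ⇒α : 2ℤ[ b ] 1# → ∃ λ d → α b d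
    1∈2ℤ⇒α (h , h∈ , e) with ℤ⇒Span h∈
    ... | d , s = d , 1# , h , (+ 0 , trans (sym #-1) (solve 0 (:1 := :1 :+ :2 :* :0) refl)) , s , e

  module _ {b e : Carrier} (be≈1 : b * e ≈ # (+ 1)) where

    -- Clearing denominators: as `e` is the inverse of `b`, multiplying by `bᵐ` reverses the order
    -- of the coefficients.
    reverse : ∀ m {h} → Span e m h → Span b (suc m) (b ^ m * h)
    reverse zero (nil h≈0) = weaken (nil (trans (*-congˡ h≈0) (solve 1 (λ x → x :* :0 := :0) refl (b ^ 0))))
    reverse (suc m) (cons {z = z} n s h≈) = span-resp
      (trans
        (from (sym (((b ^ m * z) ⊙ be≈1)))
          (solve 5 (λ b e n p z → n :* (b :* p) :+ p :* z :+ p :* z :* (b :* e)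
                := b :* p :* (n :+ e :* z) :+ p :* z :* :1) refl b e (# n) (b ^ m) z))
        (*-congˡ (sym h≈)))
      (span-+ (span-scale n (span-^ (suc m))) (weaken (reverse m s)))

    -- The left side is `(1 - b)ᵏ bᵐ`, a polynomial in `b` with leading coefficient `±1`, which is
    -- odd.
    leading : ∀ k m → ∃₂ λ o r → Odd o × Span b (k ℕ.+ m) r ×
              (e - # (+ 1)) ^ k * b ^ (k ℕ.+ m) ≈ o * b ^ (k ℕ.+ m) + r
    leading zero m = # (+ 1) , # (+ 0) , (+ 0 , solve 0 (:1 := :1 :+ :2 :* :0) refl) , span-0 m ,
      trans (*-congʳ (sym #-1)) (solve 1 (λ p → :1 :* p := :1 :* p :+ :0) refl (b ^ m))
    leading (suc k) m with leading k m
    ... | o , r , odd , sr , eq with odd-int odd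
    ...   | n , o≈n = # -[1+ 0 ] * o , (o * p + r) + # -[1+ 0 ] * (b * r) ,
      odd-* (-[1+ 0 ] , solve 0 (con -[1+ 0 ] := :1 :+ :2 :* con -[1+ 0 ]) refl) odd ,
      span-+ (span-+ (span-resp (*-congʳ (sym o≈n)) (span-scale n (span-^ (k ℕ.+ m)))) (weaken sr)) (span-scale -[1+ 0 ] (shift sr)) ,
      (begin
        (e - # (+ 1)) * q * (b * p)
          ≈⟨ solve 4 (λ e q b p → (e :- :1) :* q :* (b :* p) := (b :* e :- b) :* (q :* p)) refl e q b p ⟩
        (b * e - b) * (q * p)
          ≈⟨ *-cong (+-congʳ be≈1) eq ⟩
        (# (+ 1) - b) * (o * p + r)
          ≈⟨ solve 4 (λ b o p r → (:1 :- b) :* (o :* p :+ r)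
                := con -[1+ 0 ] :* o :* (b :* p) :+ (o :* p :+ r :+ con -[1+ 0 ] :* (b :* r))) refl b o p r ⟩
        # -[1+ 0 ] * o * (b * p) + (o * p + r + # -[1+ 0 ] * (b * r)) ∎)
      where
      open import Relation.Binary.Reasoning.Setoid setoid
      p = b ^ (k ℕ.+ m)
      q = (e - # (+ 1)) ^ k

    -- Multiply `(e - 1)ᵏ = 2 h` by `bᵏ⁺ᵐ`, where `m` bounds the size of `h`. Both sides become
    -- polynomials in `b`, with odd top coefficient `o` on the left and even `2 γ` on the right, so
    -- `(o - 2 γ) bᵏ⁺ᵐ` lies in the lower powers. This is integrality of `b` over the integers
    -- localised at 2.
    inverse⇒β : ∀ k → 2ℤ[ e ] ((e - # (+ 1)) ^ k) → ∃ λ m → β b m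
    inverse⇒β k (h , h∈ , eq) with ℤ⇒Span h∈
    ... | m , s with leading k m
    ...   | o , r , odd , sr , lead with top (k ℕ.+ m) (subst (λ j → Span b j (b ^ k * (b ^ m * h))) (ℕ.+-suc k m) (shift^ k (reverse m s)))
      where
      shift^ : ∀ j {i y} → Span b i y → Span b (j ℕ.+ i) (b ^ j * y)
      shift^ zero    {y = y} s = span-resp (sym (*-identityˡ y)) s
      shift^ (suc j) {y = y} s = span-resp (sym (*-assoc b (b ^ j) y)) (shift (shift^ j s))
    ...     | γ , z , sz , hb≈ = k ℕ.+ m , o + # (+ 2) * # (ℤ.- γ) , odd-+2 (ℤ.- γ) odd ,
      span-resp
        (sym (from (trans (sym lead) (trans (*-cong eq (^-homo-* b k m))
                (trans (solve 4 (λ t h u v → t :* h :* (u :* v)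
                      := t :* (u :* (v :* h))) refl (# (+ 2)) h (b ^ k) (b ^ m)) (*-congˡ hb≈))))
          (trans (+-congʳ (*-congʳ (+-congˡ (*-congˡ (#-homo-neg γ)))))
          (solve 5 (λ o γ p r z → (o :+ :2 :* (:- γ)) :* p :+ :2 :* (γ :* p :+ z)
                := :2 :* z :+ con -[1+ 0 ] :* r :+ (o :* p :+ r)) refl o (# γ) (b ^ (k ℕ.+ m)) r z))))
        (span-+ (span-scale (+ 2) sz) (span-scale -[1+ 0 ] sr))

  coprime⇒α : ∀ {b} j k → 2ℤ[ b ] ((# (+ 2) - b) ^ j) → 2ℤ[ b ] ((# (+ 1) - b) ^ k) → ∃ λ d → α b d
  coprime⇒α {b} j k uʲ vᵏ = 1∈2ℤ⇒α (comaximal j k (add (int (+ 2)) (neg gen)) (add (int (+ 1)) (neg gen))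
    (solve 1 (λ b → :2 :- b := :1 :+ (:1 :- b)) refl b) uʲ vᵏ)

-- The elliptic curve and its doubling map.

module EllipticCurve {c ℓ : Level} (K : NumberField c ℓ) where
  open Field K

  cubic : Carrier → Carrier → Carrier
  cubic A x = x * x * x + (A + # (+ 4)) * (x * x) + (# (+ 6) * A - # (+ 4)) * x + A * A

  :cubic : ∀ {n} → Polynomial n → Polynomial n → Polynomial n
  :cubic A x = x :* x :* x :+ (A :+ :4) :* (x :* x) :+ (con (+ 6) :* A :- :4) :* x :+ A :* A

  OnCurve : Carrier → Carrier → Carrier → Set ℓ
  OnCurve A x η = η * η ≈ cubic A x

  AvoidingPoint : Carrier → List Carrier → Set (c ⊔ ℓ)
  AvoidingPoint A F = ∃₂ λ x η → OnCurve A x η × All (λ y → ¬ (x ≈ y)) F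

  -- `x₂-eq` is the duplication formula with its denominator `4 η²` cleared. With `a₂ = A + 4`,
  -- `a₄ = 6 A - 4` and `a₆ = A²` its right side is `x⁴ - 2 a₄ x² - 8 a₆ x + a₄² - 4 a₂ a₆`.
  record Double (A x η : Carrier) : Set (c ⊔ ℓ) where
    field
      x₂ η₂   : Carrier
      onCurve : OnCurve A x₂ η₂
      x₂-eq   : x₂ * (# (+ 4) * (η * η)) ≈
                x * x * (x * x) - # (+ 2) * (# (+ 6) * A - # (+ 4)) * (x * x) - # (+ 8) * (A * A) * x
                + ((# (+ 6) * A - # (+ 4)) * (# (+ 6) * A - # (+ 4)) - # (+ 4) * (A + # (+ 4)) * (A * A))

  -- The tangent, of slope `λ′`, meets the curve doubly at the given point; the third intersection,
  -- reflected in the axis `η = 0`, is the double.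
  double : ∀ {A x η} → OnCurve A x η → ¬ (η ≈ 0#) → Double A x η
  double {A} {x} {η} curve η≉0 with inverse (# (+ 2) * η) (*-≉0 2≉0 η≉0)
  ... | d , 2ηd≈1 = record
    { x₂ = x₂
    ; η₂ = - (η + λ′ * (x₂ - x))
    ; onCurve = from (curve ⊕ (x₂ - x) ⊙ tangent)
        (solve 4 (λ A x η l → let x₂ = l :* l :- (A :+ :4) :- :2 :* x ; η₂ = :- (η :+ l :* (x₂ :- x)) in
            η₂ :* η₂ :+ (:cubic A x :+ (x₂ :- x) :* :slope A x)
            := :cubic A x₂ :+ (η :* η :+ (x₂ :- x) :* (:2 :* η :* l)))
          refl A x η λ′)
    ; x₂-eq = from (*-cong tangent tangent ⊕ (# -[1+ 3 ] * (A + # (+ 4) + # (+ 2) * x)) ⊙ curve)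
        (solve 4 (λ A x η l →
            (l :* l :- (A :+ :4) :- :2 :* x) :* (:4 :* (η :* η))
              :+ (:slope A x :* :slope A x :+ con -[1+ 3 ] :* (A :+ :4 :+ :2 :* x) :* :cubic A x)
            := (x :* x :* (x :* x) :- :2 :* (con (+ 6) :* A :- :4) :* (x :* x) :- con (+ 8) :* (A :* A) :* x
                :+ ((con (+ 6) :* A :- :4) :* (con (+ 6) :* A :- :4) :- :4 :* (A :+ :4) :* (A :* A)))
              :+ (:2 :* η :* l :* (:2 :* η :* l) :+ con -[1+ 3 ] :* (A :+ :4 :+ :2 :* x) :* (η :* η)))
          refl A x η λ′)
    }
    where
    :slope : ∀ {n} → Polynomial n → Polynomial n → Polynomial n
    :slope A x = :3 :* (x :* x) :+ :2 :* (A :+ :4) :* x :+ (con (+ 6) :* A :- :4)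
    slope λ′ x₂ : Carrier
    slope = # (+ 3) * (x * x) + # (+ 2) * (A + # (+ 4)) * x + (# (+ 6) * A - # (+ 4))
    λ′ = slope * d
    x₂ = λ′ * λ′ - (A + # (+ 4)) - # (+ 2) * x
    tangent : # (+ 2) * η * λ′ ≈ slope
    tangent = trans (solve 3 (λ η s d → :2 :* η :* (s :* d) := s :* (:2 :* η :* d)) refl η slope d)
      (trans (*-congˡ 2ηd≈1) (*-identityʳ slope))

-- Orbits under doubling, modulo 2.

-- The coordinate is scaled by ε so that both A = b, ε = 1 and A = 1 / b, ε = b
-- give a curve over ℤ[ b ].
module Orbit {c ℓ : Level} (K : NumberField c ℓ) where
  open Field K
  open Integrality K
  open EllipticCurve K

  -- In `X = ε x` the cubic, times `ε³`, becomes `X³ + α₂ X² + 2 β₄ X + α₆`. Requiring half of the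
  -- linear coefficient to be integral makes the duplication numerator congruent to `X⁴` modulo 2.
  -- The element `t` will be the starting value of `X`.
  module Scaled (A ε b : Carrier) (ε≉0 : ¬ (ε ≈ 0#))
    (α₂ β₄ α₆ : Carrier) (α₂∈ : ℤ[ b ] α₂) (β₄∈ : ℤ[ b ] β₄) (α₆∈ : ℤ[ b ] α₆)
    (α₂≈ : α₂ ≈ ε * (A + # (+ 4)))
    (2β₄≈ : # (+ 2) * β₄ ≈ ε * ε * (# (+ 6) * A - # (+ 4)))
    (α₆≈ : α₆ ≈ ε * ε * ε * (A * A))
    (t : Carrier) (t∈ : ℤ[ b ] t) where

    -- What an orbit under doubling forces when it repeats or meets the 2-torsion.
    Torsion : Set (c ⊔ ℓ)
    Torsion = ∃ λ k → 2ℤ[ b ] (t ^ k)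

    PowerMod2 : Carrier → Set (c ⊔ ℓ)
    PowerMod2 X = ∃₂ λ k y → 2ℤ[ b ] y × X ≈ t ^ k + y

    powerMod2-∈ : ∀ {X} → PowerMod2 X → ℤ[ b ] X
    powerMod2-∈ (k , y , (h , h∈ , y≈) , X≈) =
      resp (sym (trans X≈ (+-congˡ y≈))) (add (pow k t∈) (mul (int (+ 2)) h∈))

    powerMod2-* : ∀ {X Y} → PowerMod2 X → PowerMod2 Y → PowerMod2 (X * Y)
    powerMod2-* {X} {Y} X∈@(k , x , x∈ , X≈) Y∈@(l , y , y∈ , Y≈) = k ℕ.+ l , X * y + t ^ l * x ,
      2ℤ-add (2ℤ-scale (powerMod2-∈ X∈) y∈) (2ℤ-scale (pow l t∈) x∈) ,
      trans (*-congˡ Y≈) (trans (*-congʳ X≈) (trans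
        (trans (solve 4 (λ p q x y → (p :+ x) :* (q :+ y)
              := p :* q :+ ((p :+ x) :* y :+ q :* x)) refl (t ^ k) (t ^ l) x y)
               (+-congˡ (+-congʳ (*-congʳ (sym X≈)))))
        (+-congʳ (sym (^-homo-* t k l)))))

    powerMod2-+ : ∀ {X y} → PowerMod2 X → 2ℤ[ b ] y → PowerMod2 (X + y)
    powerMod2-+ {X} {y} (k , x , x∈ , X≈) y∈ = k , x + y , 2ℤ-add x∈ y∈ , trans (+-congʳ X≈) (+-assoc _ _ _)

    powerMod2-even : ∀ {X} → PowerMod2 X → 2ℤ[ b ] X → Torsion
    powerMod2-even {X} (k , y , y∈ , X≈) X∈ = k ,
      2ℤ-resp (from X≈ (solve 3 (λ p X y → X :+ con -[1+ 0 ] :* y :+ (p :+ y)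
            := p :+ X) refl (t ^ k) X y)) (2ℤ-add X∈ (2ℤ-scale (int -[1+ 0 ]) y∈))

    -- `X` and `Z` are integral homogeneous coordinates of `ε x`. `alive` excludes a start with
    -- `η = 0`, from which no divisibility by 2 would follow; after a doubling `Z` is even, and
    -- there `η = 0` is informative.
    record Point : Set (c ⊔ ℓ) where
      field
        x η X Z : Carrier
        onCurve : OnCurve A x η
        Z∈      : ℤ[ b ] Z
        Z≉0     : ¬ (Z ≈ 0#)
        X≈      : X ≈ ε * x * Z
        X-pm2   : PowerMod2 X
        alive   : ¬ (η ≈ 0#) ⊎ 2ℤ[ b ] Z

    Later : Point → Point → Set (c ⊔ ℓ)
    Later P Q = ∃ λ w → ℤ[ b ] w × Point.Z Q ≈ w * Point.Z P

    Next : Point → Point → Set (c ⊔ ℓ)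
    Next P Q = ∃ λ w → ℤ[ b ] w × Point.Z Q ≈ # (+ 2) * w * Point.Z P

    -- With `C` the homogenised cubic, doubling sends `(X : Z)` to `(X⁴ + 2 Y : 4 Z C)`. If `η = 0`
    -- then `C = 0`, so `X³ = - Z R` is even, and `X³` is a power of `t` modulo 2.
    step : ∀ P → Torsion ⊎ ∃ (Next P)
    step P = go (≈0? η)
      where
      open Point P
      R C : Carrier
      R = α₂ * (X * X) + # (+ 2) * β₄ * X * Z + α₆ * (Z * Z)
      C = X * X * X + Z * R
      C≈ : C ≈ Z * Z * Z * (ε * ε * ε * (η * η))
      C≈ = begin
        C ≈⟨ +-cong (*-cong (*-cong X≈ X≈) X≈) (*-congˡ (+-cong (+-cong (*-cong α₂≈ (*-cong X≈ X≈)) (*-congʳ (*-cong 2β₄≈ X≈))) (*-congʳ α₆≈))) ⟩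
        _ ≈⟨ solve 4 (λ A e x Z → let X = e :* x :* Z in
               X :* X :* X :+ Z :* (e :* (A :+ :4) :* (X :* X) :+ e :* e :* (con (+ 6) :* A :- :4) :* X :* Z :+ e :* e :* e :* (A :* A) :* (Z :* Z))
               := Z :* Z :* Z :* (e :* e :* e :* :cubic A x)) refl A ε x Z ⟩
        Z * Z * Z * (ε * ε * ε * cubic A x) ≈⟨ *-congˡ (*-congˡ onCurve) ⟨
        Z * Z * Z * (ε * ε * ε * (η * η)) ∎
        where open import Relation.Binary.Reasoning.Setoid setoid
      X∈ = powerMod2-∈ X-pm2
      R∈ : ℤ[ b ] R
      R∈ = add (add (mul α₂∈ (mul X∈ X∈)) (mul (mul (mul (int (+ 2)) β₄∈) X∈) Z∈)) (mul α₆∈ (mul Z∈ Z∈))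
      C∈ : ℤ[ b ] C
      C∈ = add (mul (mul X∈ X∈) X∈) (mul Z∈ R∈)
      X³-pm2 = powerMod2-* (powerMod2-* X-pm2 X-pm2) X-pm2
      X′ Y Z′ : Carrier
      -- Half of what the duplication numerator adds to `X⁴`; the square of the linear coefficient
      -- `2 β₄` is even too.
      Y = # -[1+ 1 ] * β₄ * (X * X) * (Z * Z) + # -[1+ 3 ] * α₆ * X * (Z * Z * Z) + (# (+ 2) * β₄ * β₄ + # -[1+ 1 ] * α₂ * α₆) * (Z * Z * Z * Z)
      Y∈ : ℤ[ b ] Y
      Y∈ = add (add (mul (mul (mul (int _) β₄∈) (mul X∈ X∈)) (mul Z∈ Z∈)) (mul (mul (mul (int _) α₆∈) X∈) (mul (mul Z∈ Z∈) Z∈)))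
        (mul (add (mul (mul (int _) β₄∈) β₄∈) (mul (mul (int _) α₂∈) α₆∈)) (mul (mul (mul Z∈ Z∈) Z∈) Z∈))
      X′ = X * X * X * X + # (+ 2) * Y
      Z′ = # (+ 4) * Z * C
      go : Dec (η ≈ 0#) → Torsion ⊎ ∃ (Next P)
      go (yes η≈0) = inj₁ (vanish alive)
        where
        C≈0 : C ≈ # (+ 0)
        C≈0 = trans C≈ (trans (*-congˡ (*-congˡ (*-cong (trans η≈0 (sym #-0)) (trans η≈0 (sym #-0)))))
          (solve 2 (λ Z e → Z :* Z :* Z :* (e :* e :* e :* (:0 :* :0)) := :0) refl Z ε))
        vanish : ¬ (η ≈ 0#) ⊎ 2ℤ[ b ] Z → Torsion
        vanish (inj₁ η≉0) = ⊥-elim (η≉0 η≈0)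
        vanish (inj₂ Z-even) = powerMod2-even X³-pm2 (2ℤ-resp
          (sym (from C≈0 (solve 3 (λ X R Z → X :* X :* X :+ :0
                := con -[1+ 0 ] :* R :* Z :+ (X :* X :* X :+ Z :* R)) refl X R Z)))
          (2ℤ-scale (mul (int -[1+ 0 ]) R∈) Z-even))
      go (no η≉0) = inj₂ (record
        { x = x₂ ; η = η₂ ; X = X′ ; Z = Z′
        ; onCurve = Double.onCurve D
        ; Z∈ = mul (mul (int _) Z∈) C∈
        ; Z≉0 = *-≉0 (*-≉0 (#≉0 (+ 4) (λ ())) Z≉0) (λ C≈0 → *-≉0 (*-≉0 (*-≉0 Z≉0 Z≉0) Z≉0) (*-≉0 (*-≉0 (*-≉0 ε≉0 ε≉0) ε≉0) (*-≉0 η≉0 η≉0)) (trans (sym C≈) C≈0))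
        ; X≈ = X′≈
        ; X-pm2 = powerMod2-+ (powerMod2-* X³-pm2 X-pm2) (Y , Y∈ , refl)
        ; alive = inj₂ ((# (+ 2) * Z * C , mul (mul (int _) Z∈) C∈ ,
            solve 2 (λ Z C → :4 :* Z :* C := :2 :* (:2 :* Z :* C)) refl Z C))
        } , # (+ 2) * C , mul (int _) C∈ , solve 2 (λ Z C → :4 :* Z :* C := :2 :* (:2 :* C) :* Z) refl Z C)
        where
        D = double onCurve η≉0
        open Double D using (x₂; η₂; x₂-eq)
        X′≈ : X′ ≈ ε * x₂ * Z′
        X′≈ = begin
          X′ ≈⟨ +-congˡ
                (solve 5 (λ X Z a b d → :2 :* (con -[1+ 1 ] :* b :* (X :* X) :* (Z :* Z) :+ con -[1+ 3 ] :* d :* X :* (Z :* Z :* Z) :+ (:2 :* b :* b :+ con -[1+ 1 ] :* a :* d) :* (Z :* Z :* Z :* Z))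
                  := con -[1+ 1 ] :* (:2 :* b) :* (X :* X) :* (Z :* Z) :+ con -[1+ 7 ] :* d :* X :* (Z :* Z :* Z) :+ (:2 :* b :* (:2 :* b) :+ con -[1+ 3 ] :* (a :* d)) :* (Z :* Z :* Z :* Z))
                        refl X Z α₂ β₄ α₆) ⟩
          _ ≈⟨ +-cong (*-cong (*-cong (*-cong X≈ X≈) X≈) X≈) (+-cong (+-cong (*-congʳ (*-cong (*-congˡ 2β₄≈) (*-cong X≈ X≈))) (*-congʳ (*-cong (*-congˡ α₆≈) X≈))) (*-congʳ (+-cong (*-cong 2β₄≈ 2β₄≈) (*-congˡ (*-cong α₂≈ α₆≈))))) ⟩
          _ ≈⟨ solve 4 (λ A e x Z → let X = e :* x :* Z ; β = e :* e :* (con (+ 6) :* A :- :4) ; γ = e :* e :* e :* (A :* A) in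
                 X :* X :* X :* X :+ (con -[1+ 1 ] :* β :* (X :* X) :* (Z :* Z) :+ con -[1+ 7 ] :* γ :* X :* (Z :* Z :* Z) :+ (β :* β :+ con -[1+ 3 ] :* (e :* (A :+ :4) :* γ)) :* (Z :* Z :* Z :* Z))
                 := Z :* (e :* (Z :* Z :* Z) :* (e :* e :* e)) :*
                   (x :* x :* (x :* x) :- :2 :* (con (+ 6) :* A :- :4) :* (x :* x) :- con (+ 8) :* (A :* A) :* x
                     :+ ((con (+ 6) :* A :- :4) :* (con (+ 6) :* A :- :4) :- :4 :* (A :+ :4) :* (A :* A))))
                           refl A ε x Z ⟩
          _ ≈⟨ *-congˡ x₂-eq ⟨
          Z * (ε * (Z * Z * Z) * (ε * ε * ε)) * (x₂ * (# (+ 4) * (η * η)))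
            ≈⟨ solve 4 (λ e Z x₂ η → Z :* (e :* (Z :* Z :* Z) :* (e :* e :* e)) :* (x₂ :* (:4 :* (η :* η)))
                  := e :* x₂ :* (:4 :* Z :* (Z :* Z :* Z :* (e :* e :* e :* (η :* η))))) refl ε Z x₂ η ⟩
          ε * x₂ * (# (+ 4) * Z * (Z * Z * Z * (ε * ε * ε * (η * η)))) ≈⟨ *-congˡ (*-congˡ C≈) ⟨
          ε * x₂ * Z′ ∎
          where open import Relation.Binary.Reasoning.Setoid setoid

    -- Each doubling multiplies Z by an even element, so two equal x-coordinates
    -- X / (ε Z) make the later X even.
    avoid : ∀ F P → Torsion ⊎ ∃ λ Q → Later P Q × All (λ y → ¬ (Point.x Q ≈ y)) F
    avoid []      P = inj₂ (P , (# (+ 1) , int _ , trans (sym (*-identityˡ _)) (*-congʳ (sym #-1))) , [])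
    avoid (y ∷ F) P with avoid F P
    ... | inj₁ tors = inj₁ tors
    ... | inj₂ (Q , P≤Q@(u , u∈ , Q≈) , Q∉F) with Point.x Q ≟ y
    ...   | no Q≉y = inj₂ (Q , P≤Q , Q≉y ∷ Q∉F)
    -- `Q` avoids `F` but hits `y`: double it and look further along the orbit for a point `R`
    -- avoiding `F`. Only a second hit of `y` remains to be excluded.
    ...   | yes Q≈y with step Q
    ...     | inj₁ tors = inj₁ tors
    ...     | inj₂ (Q′ , w , w∈ , Q′≈) with avoid F Q′
    ...       | inj₁ tors = inj₁ tors
    ...       | inj₂ (R , (v , v∈ , R≈) , R∉F) with Point.x R ≟ y
    ...         | no R≉y = inj₂ (R , later , R≉y ∷ R∉F)
        where
        later : Later P R
        later = v * (# (+ 2) * w * u) , mul v∈ (mul (mul (int _) w∈) u∈) ,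
          trans (trans R≈ (*-congˡ (trans Q′≈ (*-congˡ Q≈)))) (solve 4 (λ v w u z → v :* (:2 :* w :* (u :* z))
                := v :* (:2 :* w :* u) :* z) refl v w u (Point.Z P))
    ...         | yes R≈y = inj₁ (powerMod2-even (Point.X-pm2 R) ( v * w * Point.X Q , mul (mul v∈ w∈) (powerMod2-∈ (Point.X-pm2 Q)) ,
          (begin
            Point.X R ≈⟨ Point.X≈ R ⟩
            ε * Point.x R * Point.Z R ≈⟨ *-cong (*-congˡ (trans R≈y (sym Q≈y))) (trans R≈ (*-congˡ Q′≈)) ⟩
            ε * Point.x Q * (v * (# (+ 2) * w * Point.Z Q)) ≈⟨ solve 5 (λ e x v w z → e :* x :* (v :* (:2 :* w :* z))
                  := :2 :* (v :* w :* (e :* x :* z))) refl ε (Point.x Q) v w (Point.Z Q) ⟩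
            # (+ 2) * (v * w * (ε * Point.x Q * Point.Z Q)) ≈⟨ *-congˡ (*-congˡ (Point.X≈ Q)) ⟨
            # (+ 2) * (v * w * Point.X Q) ∎)))
        where open import Relation.Binary.Reasoning.Setoid setoid

    torsion-or-avoiding : Point → ∀ F → Torsion ⊎ AvoidingPoint A F
    torsion-or-avoiding P F with avoid F P
    ... | inj₁ tors          = inj₁ tors
    ... | inj₂ (Q , _ , Q∉F) = inj₂ (Point.x Q , Point.η Q , Point.onCurve Q , Q∉F)

-- Three starting points, and a point of the curve outside any finite list.

module Points {c ℓ : Level} (K : NumberField c ℓ) where
  open Field K
  open Integrality K
  open EllipticCurve K
  open Orbit K

  module _ (A : Carrier) where

    module Unscaled (t : Carrier) (t∈ : ℤ[ A ] t) =
      Scaled A (# (+ 1)) A 1≉0 (A + # (+ 4)) (# (+ 3) * A - # (+ 2)) (A * A)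
        (add gen (int (+ 4))) (add (mul (int (+ 3)) gen) (neg (int (+ 2)))) (mul gen gen)
        (solve 1 (λ A → A :+ :4 := :1 :* (A :+ :4)) refl A)
        (solve 1 (λ A → :2 :* (:3 :* A :- :2) := :1 :* :1 :* (con (+ 6) :* A :- :4)) refl A)
        (solve 1 (λ A → A :* A := :1 :* :1 :* :1 :* (A :* A)) refl A)
        t t∈

    first-orbit : ∀ F → (∃ λ k → 2ℤ[ A ] ((# (+ 1) - A) ^ k)) ⊎ AvoidingPoint A F
    first-orbit = U.torsion-or-avoiding start
      where
      module U = Unscaled (# (+ 1) - A) (add (int (+ 1)) (neg gen))
      start : U.Point
      start = record
        { x = # (+ 1) - A ; η = # (+ 1) ; X = # (+ 1) - A ; Z = # (+ 1)
        ; onCurve = solve 1 (λ A → :1 :* :1 := :cubic A (:1 :- A)) refl A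
        ; Z∈ = int (+ 1) ; Z≉0 = 1≉0
        ; X≈ = solve 1 (λ A → :1 :- A := :1 :* (:1 :- A) :* :1) refl A
        ; X-pm2 = 1 , # (+ 0) , (# (+ 0) , int (+ 0) , solve 0 (:0 := :2 :* :0) refl) ,
            trans (sym (*-identityʳ _)) (solve 1 (λ y → y := y :+ :0) refl ((# (+ 1) - A) * 1#))
        ; alive = inj₁ 1≉0
        }

    second-orbit : ∀ F → (∃ λ k → 2ℤ[ A ] ((# (+ 2) - A) ^ k)) ⊎ AvoidingPoint A F
    second-orbit F with A ≟ # (+ 4)
    -- At `A = 4` the starting point has order two, but there `2 - A = -2` is itself even.
    ... | yes A≈4 = inj₁ (1 , # -[1+ 0 ] , int _ , trans (*-identityʳ _)
            (trans (+-congˡ (-‿cong A≈4)) (solve 0 (:2 :- :4 := :2 :* con -[1+ 0 ]) refl)))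
    ... | no  A≉4 = U.torsion-or-avoiding start F
      where
      module U = Unscaled (# (+ 2) - A) (add (int (+ 2)) (neg gen))
      start : U.Point
      start = record
        { x = # (+ 2) - A ; η = A - # (+ 4) ; X = # (+ 2) - A ; Z = # (+ 1)
        ; onCurve = solve 1 (λ A → (A :- :4) :* (A :- :4) := :cubic A (:2 :- A)) refl A
        ; Z∈ = int (+ 1) ; Z≉0 = 1≉0
        ; X≈ = solve 1 (λ A → :2 :- A := :1 :* (:2 :- A) :* :1) refl A
        ; X-pm2 = 1 , # (+ 0) , (# (+ 0) , int (+ 0) , solve 0 (:0 := :2 :* :0) refl) ,
            trans (sym (*-identityʳ _)) (solve 1 (λ y → y := y :+ :0) refl ((# (+ 2) - A) * 1#))
        ; alive = inj₁ (λ e → A≉4 (x∙y⁻¹≈ε⇒x≈y A (# (+ 4)) e))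
        }

    -- Scaling by `ε = e` turns the coefficients into `1 + 4 e`, `2 (3 e - 2 e²)` and `e`, which are
    -- polynomials in `e`, and the starting coordinate `1 - A` into `e - 1`.
    reciprocal-orbit : ∀ e → A * e ≈ # (+ 1) → ∀ F →
                       (∃ λ k → 2ℤ[ e ] ((e - # (+ 1)) ^ k)) ⊎ AvoidingPoint A F
    reciprocal-orbit e Ae≈1 = U.torsion-or-avoiding start
      where
      e≉0 : ¬ (e ≈ 0#)
      e≉0 e≈0 = 1≉0 (trans (sym Ae≈1) (trans (*-congˡ e≈0) (zeroʳ A)))
      module U = Scaled A e e e≉0 (# (+ 1) + # (+ 4) * e) (# (+ 3) * e - # (+ 2) * (e * e)) e
        (add (int (+ 1)) (mul (int (+ 4)) gen)) (add (mul (int (+ 3)) gen) (neg (mul (int (+ 2)) (mul gen gen)))) gen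
        (from (sym Ae≈1) (solve 2 (λ A e → :1 :+ :4 :* e :+ A :* e := e :* (A :+ :4) :+ :1) refl A e))
        (from ((# (+ 6) * e) ⊙ sym Ae≈1)
              (solve 2 (λ A e → :2 :* (:3 :* e :- :2 :* (e :* e)) :+ con (+ 6) :* e :* (A :* e)
              := e :* e :* (con (+ 6) :* A :- :4) :+ con (+ 6) :* e :* :1) refl A e))
        (from (e ⊙ *-cong (sym Ae≈1) (sym Ae≈1)) (solve 2 (λ A e → e :+ e :* (A :* e :* (A :* e))
              := e :* e :* e :* (A :* A) :+ e :* (:1 :* :1)) refl A e))
        (e - # (+ 1)) (add gen (neg (int (+ 1))))
      start : U.Point
      start = record
        { x = # (+ 1) - A ; η = # (+ 1) ; X = e - # (+ 1) ; Z = # (+ 1)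
        ; onCurve = solve 1 (λ A → :1 :* :1 := :cubic A (:1 :- A)) refl A
        ; Z∈ = int (+ 1) ; Z≉0 = 1≉0
        ; X≈ = from Ae≈1 (solve 2 (λ A e → e :- :1 :+ :1 := e :* (:1 :- A) :* :1 :+ A :* e) refl A e)
        ; X-pm2 = 1 , # (+ 0) , (# (+ 0) , int (+ 0) , solve 0 (:0 := :2 :* :0) refl) ,
            trans (sym (*-identityʳ _)) (solve 1 (λ y → y := y :+ :0) refl ((e - # (+ 1)) * 1#))
        ; alive = inj₁ 1≉0
        }

    -- The three orbits are tried in turn. Failure of the first two yields `α`, which also shows
    -- `A ≠ 0`; only then is the inverse `e` available for the third, whose failure yields `β` and
    -- contradicts `α`.
    avoidingPoint : ∀ F → AvoidingPoint A F
    avoidingPoint F = first (first-orbit F)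
      where
      third : ∀ {e d} → A * e ≈ # (+ 1) → α A d →
              (∃ λ k → 2ℤ[ e ] ((e - # (+ 1)) ^ k)) ⊎ AvoidingPoint A F → AvoidingPoint A F
      third Ae≈1 α-d (inj₂ P)          = P
      third Ae≈1 α-d (inj₁ (i , tors)) =
        ⊥-elim (α-β-absurd (α-≉0 α-d) α-d (proj₂ (inverse⇒β Ae≈1 i tors)))

      second : ∀ {k} → 2ℤ[ A ] ((# (+ 1) - A) ^ k) →
               (∃ λ j → 2ℤ[ A ] ((# (+ 2) - A) ^ j)) ⊎ AvoidingPoint A F → AvoidingPoint A F
      second         vᵏ (inj₂ P)        = P
      second {k = k} vᵏ (inj₁ (j , uʲ)) = third Ae≈1 α-d (reciprocal-orbit e Ae≈1 F)
        where
        α-d = proj₂ (coprime⇒α j k uʲ vᵏ)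
        e = proj₁ (inverse A (α-≉0 α-d))
        Ae≈1 : A * e ≈ # (+ 1)
        Ae≈1 = trans (proj₂ (inverse A (α-≉0 α-d))) (sym #-1)

      first : (∃ λ k → 2ℤ[ A ] ((# (+ 1) - A) ^ k)) ⊎ AvoidingPoint A F → AvoidingPoint A F
      first (inj₂ P)        = P
      first (inj₁ (k , vᵏ)) = second {k} vᵏ (second-orbit F)

-- Infinite families in constructive form.

module Escape {c ℓ : Level} (K : NumberField c ℓ) where
  open Field K

  infix 4 _avoids_
  _avoids_ : Carrier → List Carrier → Set (c ⊔ ℓ)
  x avoids L = All (λ y → ¬ (x ≈ y)) L

  -- Infinitude of the set of values, in the form that produces a value outside any given list.
  Escaping : ∀ {i} {I : Set i} → (I → Carrier) → Set (c ⊔ ℓ ⊔ i)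
  Escaping y = ∀ L → ∃ λ i → y i avoids L

  -- Infinitude survives a map with finite fibres: once `z i` takes an unwanted value, letting `y`
  -- avoid `fibre i` keeps `z` from taking it again.
  escaping-fibres : ∀ {i} {I : Set i} {y z : I → Carrier} → Escaping y → (fibre : I → List Carrier) →
                    (∀ i j → z j ≈ z i → Any (y j ≈_) (fibre i)) → Escaping z
  escaping-fibres {y = y} {z} esc fibre fibre-ok F = proj₁ (both F []) , proj₂ (proj₂ (both F []))
    where
    -- The list `M` is general because a hit of `x` restarts the search with `fibre i` added to it.
    both : ∀ F M → ∃ λ i → y i avoids M × z i avoids F
    both []      M = proj₁ (esc M) , proj₂ (esc M) , []
    both (x ∷ F) M with both F M
    ... | i , i∉M , i∉F with z i ≟ x
    ...   | no  zi≉x = i , i∉M , zi≉x ∷ i∉F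
    ...   | yes zi≈x with both F (M ++ fibre i)
    ...     | j , j∉ , j∉F = j , ++⁻ˡ M j∉ ,
              (λ zj≈x → All¬⇒¬Any (++⁻ʳ M j∉) (fibre-ok i j (trans zj≈x (sym zi≈x)))) ∷ j∉F

  -- Monic polynomial functions without coefficients: dividing `p x - p y` by `x - y` lowers the
  -- degree by one and keeps the leading coefficient, down to the constant 1. This is the form in
  -- which roots are counted.
  Monic : ℕ → (Carrier → Carrier) → Set (c ⊔ ℓ)
  Monic zero    p = ∀ x → p x ≈ # (+ 1)
  Monic (suc n) p = ∀ y → ∃ λ q → Monic n q × (∀ x → p x - p y ≈ (x - y) * q x)

  -- The quotient comes from `x p(x) - y p(y) = x (p(x) - p(y)) + (x - y) p(y)`.
  monic-horner : ∀ n {p} k → Monic n p → Monic (suc n) (λ x → x * p x + k)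
  monic-horner zero {p} k p≈1 y = (λ _ → # (+ 1)) , (λ _ → refl) , λ x →
    trans (+-cong (+-congʳ (*-congˡ (p≈1 x))) (-‿cong (+-congʳ (*-congˡ (p≈1 y)))))
      (solve 3 (λ x y k → x :* :1 :+ k :- (y :* :1 :+ k) := (x :- y) :* :1) refl x y k)
  monic-horner (suc n) {p} k p-monic y with p-monic y
  ... | q , q-monic , p-p≈ = (λ x → x * q x + p y) , monic-horner n (p y) q-monic , λ x →
    from (x ⊙ p-p≈ x)
      (solve 6 (λ x y k px py q → x :* px :+ k :- (y :* py :+ k) :+ x :* ((x :- y) :* q)
            := (x :- y) :* (x :* q :+ py) :+ x :* (px :- py)) refl x y k (p x) (p y) (q x))

  -- Finitely many roots are discarded without being listed: if `y i` is a root, every other root is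
  -- one of the quotient `q`, so by induction some value outside `L` avoids both `y i` and the roots
  -- of `q`.
  escaping-roots : ∀ n {i} {I : Set i} {y : I → Carrier} {p} → Monic n p → Escaping y →
                   Escaping {I = Σ I λ i → ¬ (p (y i) ≈ # (+ 0))} (λ i → y (proj₁ i))
  escaping-roots zero {y = y} {p} p≈1 esc L with esc L
  ... | i , i∉L = (i , λ e → 1≉0 (trans (sym (p≈1 (y i))) (trans e #-0))) , i∉L
  escaping-roots (suc n) {y = y} {p} p-monic esc L with esc L
  ... | i , i∉L with p (y i) ≟ # (+ 0)
  ...   | no  p≉0 = (i , p≉0) , i∉L
  ...   | yes p≈0 with p-monic (y i)
  ...     | q , q-monic , p-p≈ with escaping-roots n q-monic esc (y i ∷ L)
  ...       | (j , q≉0) , yj≉yi ∷ j∉L = (j , λ pj≈0 →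
                *-≉0 (λ e → yj≉yi (x∙y⁻¹≈ε⇒x≈y _ _ e)) (λ q≈0 → q≉0 (trans q≈0 (sym #-0)))
                  (trans (sym (p-p≈ (y j))) (trans (+-cong pj≈0 (-‿cong p≈0)) (-‿inverseʳ _)))) , j∉L

-- From points of the curve to chains of three successive preimages.

module Chains {c ℓ : Level} (K : NumberField c ℓ) where
  open Field K
  open EllipticCurve K
  open Points K
  open Escape K

  -- Here `q` is the sum of the roots of a monic quadratic, so `q - x` is the root other than `x`.
  -- This provides the two-element fibres below.
  two-roots : ∀ {p q x y} → (y - x) * (y - (q - x)) ≈ p → p ≈ 0# → Any (y ≈_) (x ∷ q - x ∷ [])
  two-roots e p≈0 with zero-product (trans e p≈0)
  ... | inj₁ e₁ = here (x∙y⁻¹≈ε⇒x≈y _ _ e₁)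
  ... | inj₂ e₂ = there (here (x∙y⁻¹≈ε⇒x≈y _ _ e₂))

  difference≈0 : ∀ {x y} → x ≈ y → x - y ≈ 0#
  difference≈0 e = trans (+-congʳ e) (-‿inverseʳ _)

  module _ (a : Carrier) where

    A : Carrier
    A = # (+ 4) * a + # (+ 5)

    :A : ∀ {n} → Polynomial n → Polynomial n
    :A a = :4 :* a :+ con (+ 5)

    quadratic : Carrier → Carrier → Carrier
    quadratic s x = x * x - # (+ 4) * x * (s * s + s) + (A + # (+ 3)) * x - # (+ 4) * A * s + # (+ 4) * A - # (+ 4)

    :quadratic : ∀ {n} → Polynomial n → Polynomial n → Polynomial n → Polynomial n
    :quadratic A s x = x :* x :- :4 :* x :* (s :* s :+ s) :+ (A :+ :3) :* x :- :4 :* A :* s :+ :4 :* A :- :4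

    quadratic-cong : ∀ {s s′} x → s ≈ s′ → quadratic s x ≈ quadratic s′ x
    quadratic-cong x e = +-congʳ (+-congʳ (+-cong (+-congʳ (+-congˡ (-‿cong (*-congˡ (+-cong (*-cong e e) e))))) (-‿cong (*-congˡ e))))

    record Slope : Set (c ⊔ ℓ) where
      field
        x s  : Carrier
        root : quadratic s x ≈ 0#

    -- Solving `η = 2 x s + x + A` for `s` requires `x ≠ 0`. The difference of `cubic A x` and `η²`
    -- is then `x` times the quadratic, and `x` cancels.
    point⇒slope : ∀ {x η} → OnCurve A x η → ¬ (x ≈ 0#) → ∃ λ s → quadratic s x ≈ 0#
    point⇒slope {x} {η} curve x≉0 = s , integral xq≈0 x≉0
      where
      inv = inverse (# (+ 2) * x) (*-≉0 2≉0 x≉0)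
      d s : Carrier
      d = proj₁ inv
      s = (η - x - A) * d
      η≈ : η ≈ # (+ 2) * x * s + x + A
      η≈ = from ((η - x - A) ⊙ sym (trans (proj₂ inv) (sym #-1)))
        (solve 4 (λ A x η d → η :+ (η :- x :- A) :* (:2 :* x :* d)
              := :2 :* x :* ((η :- x :- A) :* d) :+ x :+ A :+ (η :- x :- A) :* :1) refl A x η d)
      xq≈0 : x * quadratic s x ≈ 0#
      xq≈0 = trans (from (sym (trans (sym (*-cong η≈ η≈)) curve))
        (solve 3 (λ A x s → x :* :quadratic A s x :+ (:2 :* x :* s :+ x :+ A) :* (:2 :* x :* s :+ x :+ A)
              := :0 :+ :cubic A x) refl A x s)) #-0

    slope-x-escapes : Escaping Slope.x
    slope-x-escapes L = go (avoidingPoint A (0# ∷ L))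
      where
      go : AvoidingPoint A (0# ∷ L) → ∃ λ i → Slope.x i avoids L
      go (x , η , curve , x≉0 ∷ x∉L) = record { x = x ; root = proj₂ (point⇒slope curve x≉0) } , x∉L

    quadratic-roots : ∀ s {x y} → quadratic s x ≈ 0# → quadratic s y ≈ 0# →
                      Any (y ≈_) (x ∷ (# (+ 4) * (s * s + s) - (A + # (+ 3))) - x ∷ [])
    quadratic-roots s {x} {y} x-root y-root = two-roots
      (solve 4 (λ A s x y → (y :- x) :* (y :- (:4 :* (s :* s :+ s) :- (A :+ :3) :- x))
            := :quadratic A s y :- :quadratic A s x) refl A s x y)
      (difference≈0 (trans y-root (sym x-root)))

    -- Infinitude travels from `x` to `s`, then to `u` and to `c`; each of these passages is at most
    -- two to one.
    slope-s-escapes : Escaping Slope.s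
    slope-s-escapes = escaping-fibres slope-x-escapes _ λ i j sj≈si →
      quadratic-roots (Slope.s i) (Slope.root i) (trans (quadratic-cong (Slope.x j) (sym sj≈si)) (Slope.root j))

    record Vertex : Set (c ⊔ ℓ) where
      field
        x s u : Carrier
        root  : quadratic s x ≈ 0#
        2s≉1  : ¬ (# (+ 1) - # (+ 2) * s ≈ 0#)
        u≈    : u * (# (+ 1) - # (+ 2) * s) ≈ s * s + a

    slope⇒vertex : ∀ i {h} → # (+ 2) * h ≈ 1# → ¬ (Slope.s i ≈ h) → ∃ λ j → Vertex.s j ≈ Slope.s i
    slope⇒vertex i 2h≈1 s≉h = record
      { x = x ; s = s ; u = (s * s + a) * proj₁ inv ; root = root ; 2s≉1 = 2s≉1
      ; u≈ = trans (trans (*-assoc _ _ _) (*-congˡ (trans (*-comm _ _) (proj₂ inv)))) (*-identityʳ _)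
      } , refl
      where
      open Slope i
      2s≉1 : ¬ (# (+ 1) - # (+ 2) * s ≈ 0#)
      2s≉1 e = s≉h (*-cancelˡ-≉0 2≉0 (trans (sym (x∙y⁻¹≈ε⇒x≈y _ _ e)) (trans #-1 (sym 2h≈1))))
      inv = inverse (# (+ 1) - # (+ 2) * s) 2s≉1

    vertex-s-escapes : Escaping Vertex.s
    vertex-s-escapes L = go (inverse (# (+ 2)) 2≉0)
      where
      go : (∃ λ h → # (+ 2) * h ≈ 1#) → ∃ λ j → Vertex.s j avoids L
      -- At `s = h`, one half, the equation for `u` degenerates, so this value is avoided as well.
      go (h , 2h≈1) = go′ (slope-s-escapes (h ∷ L))
        where
        go′ : (∃ λ i → Slope.s i avoids (h ∷ L)) → ∃ λ j → Vertex.s j avoids L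
        go′ (i , s≉h ∷ s∉L) = proj₁ j , All.map (λ s≉y e → s≉y (trans (sym (proj₂ j)) e)) s∉L
          where j = slope⇒vertex i 2h≈1 s≉h

    vertex-roots : ∀ u {s t} → u * (# (+ 1) - # (+ 2) * s) ≈ s * s + a → u * (# (+ 1) - # (+ 2) * t) ≈ t * t + a →
                   Any (t ≈_) (s ∷ # -[1+ 1 ] * u - s ∷ [])
    vertex-roots u {s} {t} us ut = two-roots
      (solve 4 (λ a u s t → (t :- s) :* (t :- (con -[1+ 1 ] :* u :- s))
            := (t :* t :+ a :- u :* (:1 :- :2 :* t)) :- (s :* s :+ a :- u :* (:1 :- :2 :* s))) refl a u s t)
      (difference≈0 (trans (difference≈0 (sym ut)) (sym (difference≈0 (sym us)))))

    vertex-u-escapes : Escaping Vertex.u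
    vertex-u-escapes = escaping-fibres vertex-s-escapes _ λ i j uj≈ui →
      vertex-roots (Vertex.u i) (Vertex.u≈ i) (trans (*-congʳ (sym uj≈ui)) (Vertex.u≈ j))

    square-roots : ∀ {u v} → a - v * v ≈ a - u * u → Any (v ≈_) (u ∷ # (+ 0) - u ∷ [])
    square-roots {u} {v} e = two-roots
      (solve 3 (λ a u v → (v :- u) :* (v :- (:0 :- u)) := (a :- u :* u) :- (a :- v :* v)) refl a u v)
      (difference≈0 (sym e))

    vertex-c-escapes : Escaping (λ i → a - Vertex.u i * Vertex.u i)
    vertex-c-escapes = escaping-fibres vertex-u-escapes _ λ _ _ → square-roots

    record Chain : Set (c ⊔ ℓ) where
      field
        k u v w : Carrier
        u²≈ : u * u + k ≈ a
        v²≈ : v * v + k ≈ u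
        w²≈ : w * w + k ≈ v

    vertex⇒chain : Vertex → Chain
    vertex⇒chain i = record
      { k = a - u * u ; u = u ; v = u + s ; w = w
      ; u²≈ = solve 2 (λ a u → u :* u :+ (a :- u :* u) := a) refl a u
      ; v²≈ = from (sym u≈) (solve 3 (λ a u s → (u :+ s) :* (u :+ s) :+ (a :- u :* u) :+ u :* (:1 :- :2 :* s)
            := u :+ (s :* s :+ a)) refl a u s)
      ; w²≈ = *-cancelˡ-≉0 (*-≉0 (#≉0 (+ 4) (λ ())) (*-≉0 2s≉1 2s≉1)) scaled
      }
      where
      open Vertex i
      r n w : Carrier
      r = # (+ 1) - # (+ 2) * s
      n = x - # (+ 2) * (s * s + s - a - # (+ 2))
      inv = inverse (# (+ 2) * r) (*-≉0 2≉0 2s≉1)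
      w = n * proj₁ inv
      2rw≈n : # (+ 2) * r * w ≈ n
      2rw≈n = trans (solve 3 (λ r n d → :2 :* r :* (n :* d) := n :* (:2 :* r :* d)) refl r n (proj₁ inv))
        (trans (*-congˡ (proj₂ inv)) (*-identityʳ n))
      -- The factor `4 r²` clears the denominators of `u` and `w`, through `u r = s² + a` and
      -- `2 r w = n`; what is left is the vanishing of the quadratic.
      scaled : # (+ 4) * (r * r) * (w * w + (a - u * u)) ≈ # (+ 4) * (r * r) * (u + s)
      scaled = from (*-cong 2rw≈n 2rw≈n ⊕ trans root (sym #-0) ⊕ # -[1+ 3 ] ⊙ (*-cong u≈ u≈ ⊕ r ⊙ u≈))
        (solve 5 (λ a x s u w → let r = :1 :- :2 :* s ; n = x :- :2 :* (s :* s :+ s :- a :- :2) ; q = s :* s :+ a in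
          :4 :* (r :* r) :* (w :* w :+ (a :- u :* u)) :+ (n :* n :+ :0 :+ con -[1+ 3 ] :* (q :* q :+ r :* q))
          := :4 :* (r :* r) :* (u :+ s) :+ (:2 :* r :* w :* (:2 :* r :* w) :+ :quadratic (:A a) s x :+ con -[1+ 3 ] :* (u :* r :* (u :* r) :+ r :* (u :* r))))
          refl a x s u w)

    chain-escapes : Escaping Chain.k
    chain-escapes L = vertex⇒chain (proj₁ (vertex-c-escapes L)) , proj₂ (vertex-c-escapes L)

-- Six distinct preimages for infinitely many parameters.

module Preimages {c ℓ : Level} (K : NumberField c ℓ) where
  open Field K
  open Escape K
  open Chains K

  module _ (a : Carrier) where
    open Chain using (k)

    -- The second iterate of 0 minus `a`, as a polynomial in the parameter, written so that
    -- `monic-horner` applies; `w-poly` is the same for the third iterate.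
    v-poly : Carrier → Carrier
    v-poly x = x * (x * # (+ 1) + # (+ 1)) + - a

    v-chain-escapes : Escaping {I = Σ (Chain a) λ i → ¬ (v-poly (k i) ≈ # (+ 0))} (λ i → k (proj₁ i))
    v-chain-escapes = escaping-roots 2
      (monic-horner 1 (- a) (monic-horner 0 (# (+ 1)) (λ _ → refl))) (chain-escapes a)

    w-poly : Carrier → Carrier
    w-poly x = x * (x * (x * (x * # (+ 1) + # (+ 2)) + # (+ 1)) + # (+ 1)) + - a

    generic-chain : Escaping {I = Σ (Σ (Chain a) λ i → ¬ (v-poly (k i) ≈ # (+ 0)))
                                    λ i → ¬ (w-poly (k (proj₁ i)) ≈ # (+ 0))} (λ i → k (proj₁ (proj₁ i)))
    generic-chain = escaping-roots 4
      (monic-horner 3 (- a) (monic-horner 2 (# (+ 1)) (monic-horner 1 (# (+ 1)) (monic-horner 0 (# (+ 2)) (λ _ → refl)))))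
      v-chain-escapes

    -- The values of k for which u = 0, u² = v² or u² = w²; `v-poly` and `w-poly`
    -- vanish where v = 0 and w = 0.
    exceptions : List Carrier
    exceptions = a ∷ a - a * a ∷ # -[1+ 0 ] - a - a * a ∷ []

    module _ (i : Chain a)
      (k∉ : k i avoids exceptions)
      (quad≉0 : ¬ (v-poly (k i) ≈ # (+ 0)))
      (quart≉0 : ¬ (w-poly (k i) ≈ # (+ 0))) where

      open Chain i using (u; v; w; u²≈; v²≈; w²≈) renaming (k to κ)

      private
        κ≉a : ¬ (κ ≈ a)
        κ≉a = All.head k∉
        κ≉a-a² : ¬ (κ ≈ a - a * a)
        κ≉a-a² = All.head (All.tail k∉)
        κ≉-1-a-a² : ¬ (κ ≈ # -[1+ 0 ] - a - a * a)
        κ≉-1-a-a² = All.head (All.tail (All.tail k∉))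

      u≉0 : ¬ (u ≈ # (+ 0))
      u≉0 e = κ≉a (from (u²≈ ⊕ (# -[1+ 0 ] * u) ⊙ e)
        (solve 3 (λ a κ u → κ :+ (a :+ con -[1+ 0 ] :* u :* :0)
              := a :+ (u :* u :+ κ :+ con -[1+ 0 ] :* u :* u)) refl a κ u))

      v≉0 : ¬ (v ≈ # (+ 0))
      v≉0 e = quad≉0 (from (u²≈ ⊕ (u + κ) ⊙ v²≈ ⊕ (# -[1+ 0 ] * (u + κ) * v) ⊙ e)
        (solve 4 (λ a κ u v → κ :* (κ :* :1 :+ :1) :+ (:- a) :+ (a :+ (u :+ κ) :* u :+ con -[1+ 0 ] :* (u :+ κ) :* v :* :0)
          := :0 :+ (u :* u :+ κ :+ (u :+ κ) :* (v :* v :+ κ) :+ con -[1+ 0 ] :* (u :+ κ) :* v :* v)) refl a κ u v))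

      w≉0 : ¬ (w ≈ # (+ 0))
      w≉0 e = quart≉0 (from (u²≈ ⊕ (κ * κ + κ + u) ⊙ (v²≈ ⊕ (v + κ) ⊙ w²≈ ⊕ (# -[1+ 0 ] * (v + κ) * w) ⊙ e))
        (solve 5 (λ a κ u v w → κ :* (κ :* (κ :* (κ :* :1 :+ :2) :+ :1) :+ :1) :+ (:- a)
              :+ (a :+ (κ :* κ :+ κ :+ u) :* (u :+ (v :+ κ) :* v :+ con -[1+ 0 ] :* (v :+ κ) :* w :* :0))
          := :0 :+ (u :* u :+ κ :+ (κ :* κ :+ κ :+ u) :* (v :* v :+ κ :+ (v :+ κ) :* (w :* w :+ κ) :+ con -[1+ 0 ] :* (v :+ κ) :* w :* w)))
                refl a κ u v w))

      -- Equal squares have equal images under `f κ`, so `u = a` and `a` is a fixed point, whence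
      -- `κ = a - a²`.
      u²≉v² : ¬ (u * u ≈ v * v)
      u²≉v² e = κ≉a-a² (from (u²≈ ⊕ (u + a) ⊙ (sym u²≈ ⊕ v²≈ ⊕ e))
        (solve 4 (λ a κ u v → κ :+ (a :+ (u :+ a) :* (u :* u :+ κ :+ u :+ v :* v))
          := a :- a :* a :+ (u :* u :+ κ :+ (u :+ a) :* (a :+ (v :* v :+ κ) :+ u :* u))) refl a κ u v))

      -- Equality would give `u = v` after one application of `f κ`, hence `u² = v²`.
      v²≉w² : ¬ (v * v ≈ w * w)
      v²≉w² e = u²≉v² (from ((u + v) ⊙ (e ⊕ sym v²≈ ⊕ w²≈))
        (solve 4 (λ κ u v w → u :* u :+ (u :+ v) :* (w :* w :+ (v :* v :+ κ) :+ v)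
          := v :* v :+ (u :+ v) :* (v :* v :+ u :+ (w :* w :+ κ))) refl κ u v w))

      -- Equality would give `v = a`, so `a` would return to itself after two steps. The factors of
      -- `period-two` correspond to `f κ a = a` and `f κ a = - 1 - a`.
      u²≉w² : ¬ (u * u ≈ w * w)
      u²≉w² e = [ (λ e₁ → κ≉a-a² (x∙y⁻¹≈ε⇒x≈y _ _ e₁)) , (λ e₂ → κ≉-1-a-a² (x∙y⁻¹≈ε⇒x≈y _ _ e₂)) ] (zero-product (trans period-two #-0))
        where
        period-two : (κ - (a - a * a)) * (κ - (# -[1+ 0 ] - a - a * a)) ≈ # (+ 0)
        period-two = from (u²≈ ⊕ (u + a * a + κ) ⊙ (v²≈ ⊕ (v + a) ⊙ (sym u²≈ ⊕ w²≈ ⊕ e)))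
          (solve 5 (λ a κ u v w → (κ :- (a :- a :* a)) :* (κ :- (con -[1+ 0 ] :- a :- a :* a))
              :+ (a :+ (u :+ a :* a :+ κ) :* (u :+ (v :+ a) :* (u :* u :+ κ :+ v :+ w :* w)))
            := :0 :+ (u :* u :+ κ :+ (u :+ a :* a :+ κ) :* (v :* v :+ κ :+ (v :+ a) :* (a :+ (w :* w :+ κ) :+ u :* u))))
                  refl a κ u v w)

      neg-square : ∀ x → - x * - x ≈ x * x
      neg-square = solve 1 (λ x → (:- x) :* (:- x) := x :* x) refl

      ≉-neg : ∀ {x} → ¬ (x ≈ # (+ 0)) → ¬ (x ≈ - x)
      ≉-neg {x} x≉0 e = x≉0 (*-cancelˡ-≉0 2≉0 (from e (solve 1 (λ x → :2 :* x :+ :- x := :2 :* :0 :+ x) refl x)))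

      -- Comparing squares settles all sign choices in `±x` and `±y` at once.
      squares-separate : ∀ {x y p q} → ¬ (x * x ≈ y * y) → p * p ≈ x * x → q * q ≈ y * y → ¬ (p ≈ q)
      squares-separate x²≉y² p² q² e = x²≉y² (trans (sym p²) (trans (*-cong e e) q²))

      preimages : Vec Carrier 6
      preimages = u ∷ - u ∷ v ∷ - v ∷ w ∷ - w ∷ []

      preimages-unique : Unique setoid preimages
      preimages-unique =
        (≉-neg u≉0 VecAll.∷ uv refl refl VecAll.∷ uv refl v² VecAll.∷ uw refl refl VecAll.∷ uw
              refl w² VecAll.∷ VecAll.[]) ∷
        (uv u² refl VecAll.∷ uv u² v² VecAll.∷ uw u² refl VecAll.∷ uw u² w² VecAll.∷ VecAll.[]) ∷
        (≉-neg v≉0 VecAll.∷ vw refl refl VecAll.∷ vw refl w² VecAll.∷ VecAll.[]) ∷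
        (vw v² refl VecAll.∷ vw v² w² VecAll.∷ VecAll.[]) ∷
        (≉-neg w≉0 VecAll.∷ VecAll.[]) ∷
        VecAll.[] ∷
        []
        where
        u² = neg-square u
        v² = neg-square v
        w² = neg-square w
        uv : ∀ {p q} → p * p ≈ u * u → q * q ≈ v * v → ¬ (p ≈ q)
        uv = squares-separate u²≉v²
        uw : ∀ {p q} → p * p ≈ u * u → q * q ≈ w * w → ¬ (p ≈ q)
        uw = squares-separate u²≉w²
        vw : ∀ {p q} → p * p ≈ v * v → q * q ≈ w * w → ¬ (p ≈ q)
        vw = squares-separate v²≉w²

      preimages-∈P : VecAll.All (InP K a κ) preimages
      preimages-∈P =
        via-u u²≈ VecAll.∷ via-u (negate u²≈) VecAll.∷
        via-v v²≈ VecAll.∷ via-v (negate v²≈) VecAll.∷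
        via-w w²≈ VecAll.∷ via-w (negate w²≈) VecAll.∷ VecAll.[]
        where
        negate : ∀ {x y} → x * x + κ ≈ y → - x * - x + κ ≈ y
        negate {x} e = trans (+-congʳ (neg-square x)) e
        apply : ∀ {x y z} → x ≈ y → y * y + κ ≈ z → x * x + κ ≈ z
        apply x≈y e = trans (+-congʳ (*-cong x≈y x≈y)) e
        via-u : ∀ {x} → x * x + κ ≈ a → InP K a κ x
        via-u e = 0 , e
        via-v : ∀ {x} → x * x + κ ≈ u → InP K a κ x
        via-v e = 1 , apply e u²≈
        via-w : ∀ {x} → x * x + κ ≈ v → InP K a κ x
        via-w e = 2 , apply (apply e v²≈) u²≈

      six-preimages : CardAtLeast K 6 a κ
      six-preimages = lookup preimages , VecAll.lookup⁺ preimages-∈P , lookup-injective setoid preimages-unique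

    κ̄≥6 : KappaAtLeast K 6 a
    κ̄≥6 F = go (generic-chain (exceptions ++ F))
      where
      go : (∃ λ i → k (proj₁ (proj₁ i)) avoids exceptions ++ F) → ∃ λ κ → ¬ Any (κ ≈_) F × CardAtLeast K 6 a κ
      go (((i , quad≉0) , quart≉0) , k∉) = k i , All¬⇒¬Any (++⁻ʳ exceptions k∉) , six-preimages i (++⁻ˡ exceptions k∉) quad≉0 quart≉0

theorem3p1 : ∀ {c ℓ : Level} (K : NumberField c ℓ) →
    ∃ λ (S : List (NumberField.Carrier K)) →
      (∀ a → SetoidMembership._∉_ (NumberField.setoid K) a S → KappaAtLeast K 6 a)
      × (∀ a → SetoidMembership._∈_ (NumberField.setoid K) a S → KappaEq K 4 a)
-- With `S` empty, the clause about the value 4 holds vacuously.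
theorem3p1 K = [] , (λ a _ → Preimages.κ̄≥6 K a) , λ a ()
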